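{- Let $q$ be an odd prime power, let $d \geq 3$ be an integer, and let $\mathcal{E} \subseteq \mathbb{F}_q^d$ satisfy $|\mathcal{E}| \geq (d-1)q^{d-1}$. Then \[ \operatorname{vol}(\mathcal{E}) = \{\operatorname{vol}(\mathbf{x}^1,\ldots,\mathbf{x}^d) : \mathbf{x}^1,\ldots,\mathbf{x}^d \in \mathcal{E}\} = \mathbb{F}_q, \] where $\operatorname{vol}(\mathbf{x}^1,\ldots,\mathbf{x}^d)$ denotes the determinant of the $d\times d$ matrix whose rows are $\mathbf{x}^1,\ldots,\mathbf{x}^d$.
   Context: $\mathbb{F}_q$ is the finite field with $q$ elements. For $\mathbf{x}^1,\ldots,\mathbf{x}^d \in \mathbb{F}_q^d$, $\operatorname{vol}(\mathbf{x}^1,\ldots,\mathbf{x}^d)$ is the determinant of the matrix with rows $\mathbf{x}^j$ (the "volume of the parallelepiped" they determine), and $\operatorname{vol}(\mathcal{E})$ is the set of all such values with all $\mathbf{x}^j$ in $\mathcal{E}$ (repetitions allowed). -}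

module Defs where

open import Level using (_⊔_)
open import Data.Nat using (ℕ; zero; suc)
open import Data.Fin using (Fin; zero; suc; toℕ; punchIn)
open import Data.Product using (Σ; _,_)
open import Relation.Nullary using (¬_)
open import Algebra.Bundles using (CommutativeRing)

record Field (c ℓ : Level.Level) : Set (Level.suc (c ⊔ ℓ)) where
  field
    commutativeRing : CommutativeRing c ℓ
  open CommutativeRing commutativeRing public
  field
    1≉0     : ¬ (1# ≈ 0#)
    inverse : ∀ x → ¬ (x ≈ 0#) → Σ Carrier (λ y → (x * y) ≈ 1#)

module _ {c ℓ} (R : CommutativeRing c ℓ) where
  open CommutativeRing R using (Carrier; 0#; 1#; _+_; _*_; -_)

  sumFin : ∀ {n} → (Fin n → Carrier) → Carrier
  sumFin {zero}  f = 0#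
  sumFin {suc n} f = f zero + sumFin (λ i → f (suc i))

  sign : ℕ → Carrier
  sign zero    = 1#
  sign (suc n) = - sign n

  -- determinant of a square matrix (M i j = entry in row i, column j),
  -- defined by Laplace (cofactor) expansion along the first row.
  det : ∀ {n} → (Fin n → Fin n → Carrier) → Carrier
  det {zero}  M = 1#
  det {suc n} M =
    sumFin (λ j → (sign (toℕ j) * M zero j) * det (λ i k → M (suc i) (punchIn j k)))

{-# OPTIONS --safe #-}

-- Quotienting by a vector of E costs a factor q of its size and one dimension, so d = 3 with
-- |E| ≥ 2q² suffices (column shears put the vector on the first axis).  There the volumes are z · (x × y).
-- If a ≠ 0 is not one of them, E misses every plane {z : z · w = a} with w in the set W of cross
-- products of E, and a second moment over planes gives |E| |W| ≤ q⁴.  On the other hand, take x in E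
-- orthogonal to the fewest elements of W, say r; always r ≥ |E| / q.  If w in W is not orthogonal to x,
-- then z ↦ x × z injects E ∩ w^⊥ into W ∩ x^⊥, so |E ∩ w^⊥| ≤ r; counting orthogonal pairs in E × W
-- (as in the de Bruijn–Erdős theorem) then gives |E| + r ≤ 2 |W|, which is incompatible.
module Submission where

open import Defs
open import Algebra.Bundles using (CommutativeRing; RawRing)
open import Algebra.Core using (Op₁; Op₂)
open import Algebra.Morphism.Structures using (IsRingMonomorphism)
import Algebra.Solver.Ring
open import Algebra.Solver.Ring.AlmostCommutativeRing using (fromCommutativeRing; _-Raw-AlmostCommutative⟶_)
open import Algebra.Structures using (IsCommutativeRing)
open import Data.Fin using (Fin; zero; suc; toℕ; punchIn; punchOut; inject₁; _≟_)
import Data.Fin as Fin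
open import Data.Fin.Induction using (>-weakInduction)
open import Data.Fin.Properties using (punchInᵢ≢i; punchIn-injective; punchIn-punchOut; toℕ-inject₁; suc-injective)
import Data.Fin.Properties as Fin
open import Data.Integer.Base as ℤ using (ℤ; -[1+_]; _⊖_; _◃_)
import Data.Integer.Properties as ℤ
import Data.Maybe.Base as Maybe
open import Data.Nat.Base as ℕ using (ℕ; zero; suc)
import Data.Nat.Properties as ℕ
open import Data.Product using (∃; ∃₂; _×_; _,_; proj₁; proj₂)
import Data.Sign.Base as Sign
open import Data.Sum using (_⊎_; inj₁; inj₂; [_,_]′)
import Data.Sum as Sum
open import Data.Unit using (tt)
open import Data.Vec.Functional using (updateAt)
open import Data.Vec.Functional.Properties using (updateAt-updates; updateAt-minimal)
open import Function using (_∘_; id)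
open import Level using (0ℓ)
open import Relation.Binary.Definitions using (DecidableEquality)
open import Relation.Binary.PropositionalEquality as ≡ using (_≡_; _≢_)
open import Relation.Nullary using (¬_; Dec; yes; no; does; contradiction)
open import Relation.Nullary.Decidable using (_×-dec_; ¬?; map′; dec⇒maybe)
open import Relation.Unary using (Decidable)

-- Determinants

-- The two bounds clash with room to spare: for |E| at least 2q² - 1 the second moment leaves at
-- most about q²/2 cross products, while the incidence count forces more than q². That count reads E
-- as points and W as lines, with x on w when x · w = 0 and x × z as the line joining x to z. Taking
-- x of least degree makes one number r serve twice, as lower bound for the degree of every point
-- and as upper bound for the size of every line missing x. The constant 2 enters through r ≥ 2q,
-- which makes the error terms of the count at most half of its main terms. The second moment needs
-- a ≠ 0, as otherwise proportional vectors define the same plane; a = 0 comes from a repeated row.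
-- It also needs nonzero vectors, so the zero vector is removed and the bounds in dimension three
-- are off by one. Shears suit the quotient because they preserve determinants exactly. Shears
-- between neighbouring columns suffice to reach the first axis, and expansion along the first row
-- handles two equal neighbouring columns directly.

punchIn-avoiding-adjacent : ∀ {n} (i : Fin (suc n)) (j : Fin (suc (suc n))) → j ≢ inject₁ i → j ≢ suc i →
  ∃ λ (i′ : Fin n) → punchIn j (inject₁ i′) ≡ inject₁ i × punchIn j (suc i′) ≡ suc i
punchIn-avoiding-adjacent zero    zero          j≢p j≢r = contradiction ≡.refl j≢p
punchIn-avoiding-adjacent zero    (suc zero)    j≢p j≢r = contradiction ≡.refl j≢r
punchIn-avoiding-adjacent {suc n} zero (suc (suc j)) j≢p j≢r = zero , ≡.refl , ≡.refl
punchIn-avoiding-adjacent (suc i) zero          j≢p j≢r = i , ≡.refl , ≡.refl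
punchIn-avoiding-adjacent {suc n} (suc i) (suc j) j≢p j≢r
  with i′ , p , r ← punchIn-avoiding-adjacent i j (j≢p ∘ ≡.cong suc) (j≢r ∘ ≡.cong suc)
  = suc i′ , ≡.cong suc p , ≡.cong suc r

punchIn-at-adjacent : ∀ {n} (i : Fin n) (k : Fin n) →
  (punchIn (inject₁ i) k ≡ punchIn (suc i) k) ⊎
  (punchIn (inject₁ i) k ≡ suc i × punchIn (suc i) k ≡ inject₁ i)
punchIn-at-adjacent zero    zero    = inj₂ (≡.refl , ≡.refl)
punchIn-at-adjacent zero    (suc k) = inj₁ ≡.refl
punchIn-at-adjacent (suc i) zero    = inj₁ ≡.refl
punchIn-at-adjacent (suc i) (suc k) =
  Sum.map (≡.cong suc) (λ (p , r) → ≡.cong suc p , ≡.cong suc r) (punchIn-at-adjacent i k)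

inject₁≢suc : ∀ {n} (i : Fin n) → inject₁ i ≢ suc i
inject₁≢suc (suc i) eq = inject₁≢suc i (suc-injective eq)

module Determinant {c ℓ} (R : CommutativeRing c ℓ) where

  open CommutativeRing R hiding (zero)
  open import Algebra.Properties.Ring ring using (-‿distribˡ-*)
  open import Relation.Binary.Reasoning.Setoid setoid
  open import Algebra.Properties.CommutativeSemigroup +-commutativeSemigroup using (interchange; x∙yz≈y∙xz)
  open import Algebra.Properties.CommutativeSemigroup *-commutativeSemigroup using () renaming (x∙yz≈y∙xz to x*yz≈y*xz)

  Matrix : ℕ → Set c
  Matrix n = Fin n → Fin n → Carrier

  sumFin-cong : ∀ {n} {f g : Fin n → Carrier} → (∀ i → f i ≈ g i) → sumFin R f ≈ sumFin R g
  sumFin-cong {zero}  h = refl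
  sumFin-cong {suc n} h = +-cong (h zero) (sumFin-cong (h ∘ suc))

  sumFin-linear : ∀ {n} a (f g : Fin n → Carrier) →
    sumFin R (λ i → f i + a * g i) ≈ sumFin R f + a * sumFin R g
  sumFin-linear {zero}  a f g = sym (trans (+-identityˡ _) (zeroʳ a))
  sumFin-linear {suc n} a f g = begin
    (f zero + a * g zero) + sumFin R (λ i → f (suc i) + a * g (suc i))
      ≈⟨ +-congˡ (sumFin-linear a (f ∘ suc) (g ∘ suc)) ⟩
    (f zero + a * g zero) + (sumFin R (f ∘ suc) + a * sumFin R (g ∘ suc))
      ≈⟨ interchange _ _ _ _ ⟩
    (f zero + sumFin R (f ∘ suc)) + (a * g zero + a * sumFin R (g ∘ suc))
      ≈⟨ +-congˡ (distribˡ a _ _) ⟨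
    (f zero + sumFin R (f ∘ suc)) + a * (g zero + sumFin R (g ∘ suc)) ∎

  sumFin-zero : ∀ {n} {f : Fin n → Carrier} → (∀ i → f i ≈ 0#) → sumFin R f ≈ 0#
  sumFin-zero {zero}  h = refl
  sumFin-zero {suc n} h = trans (+-cong (h zero) (sumFin-zero (h ∘ suc))) (+-identityˡ 0#)

  sumFin-adjacent : ∀ {n} (i : Fin n) {f : Fin (suc n) → Carrier} →
    (∀ j → j ≢ inject₁ i → j ≢ suc i → f j ≈ 0#) → f (inject₁ i) + f (suc i) ≈ 0# → sumFin R f ≈ 0#
  sumFin-adjacent zero {f} h pair = begin
    f zero + (f (suc zero) + sumFin R (λ j → f (suc (suc j))))
      ≈⟨ +-assoc _ _ _ ⟨
    (f zero + f (suc zero)) + sumFin R (λ j → f (suc (suc j)))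
      ≈⟨ +-cong pair (sumFin-zero (λ j → h (suc (suc j)) (λ ()) (λ ()))) ⟩
    0# + 0# ≈⟨ +-identityˡ 0# ⟩
    0# ∎
  sumFin-adjacent (suc i) h pair = trans
    (+-cong (h zero (λ ()) (λ ()))
      (sumFin-adjacent i (λ j j≢p j≢r → h (suc j) (j≢p ∘ suc-injective) (j≢r ∘ suc-injective)) pair))
    (+-identityˡ 0#)

  minor : ∀ {n} → Matrix (suc n) → Fin (suc n) → Matrix n
  minor M j i k = M (suc i) (punchIn j k)

  cofactorTerm : ∀ {n} → Matrix (suc n) → Fin (suc n) → Carrier
  cofactorTerm M j = (sign R (toℕ j) * M zero j) * det R (minor M j)

  det-cong : ∀ {n} {M N : Matrix n} → (∀ i k → M i k ≈ N i k) → det R M ≈ det R N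
  det-cong {zero}  h = refl
  det-cong {suc n} h = sumFin-cong λ j →
    *-cong (*-congˡ {x = sign R (toℕ j)} (h zero j)) (det-cong (λ i k → h (suc i) (punchIn j k)))

  -- In the expansion, the term at j = r has the linear entry and a minor without column r; every
  -- other term has an unchanged entry and a minor that is linear by induction. Additivity and
  -- homogeneity are joined in the shape that a shear produces.
  det-linear-column : ∀ {n} (r : Fin n) a {M M′ N : Matrix n} →
    (∀ i k → k ≢ r → N i k ≈ M i k) → (∀ i k → k ≢ r → N i k ≈ M′ i k) →
    (∀ i → N i r ≈ M i r + a * M′ i r) →
    det R N ≈ det R M + a * det R M′
  det-linear-column {suc n} r a {M} {M′} {N} hM hM′ hr =
    trans (sumFin-cong term) (sumFin-linear a (cofactorTerm M) (cofactorTerm M′))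
    where
    term : ∀ j → cofactorTerm N j ≈ cofactorTerm M j + a * cofactorTerm M′ j
    term j with j ≟ r
    ... | yes ≡.refl = begin
      (s * N zero j) * det R (minor N j)
        ≈⟨ *-congʳ (*-congˡ (hr zero)) ⟩
      (s * (M zero j + a * M′ zero j)) * det R (minor N j)
        ≈⟨ *-congʳ (trans (distribˡ s _ _) (+-congˡ (x*yz≈y*xz s a _))) ⟩
      (s * M zero j + a * (s * M′ zero j)) * det R (minor N j)
        ≈⟨ distribʳ _ _ _ ⟩
      (s * M zero j) * det R (minor N j) + (a * (s * M′ zero j)) * det R (minor N j)
        ≈⟨ +-cong (*-congˡ (det-cong (λ i k → hM (suc i) _ (punchInᵢ≢i j k))))
                  (trans (*-assoc a _ _) (*-congˡ (*-congˡ (det-cong (λ i k → hM′ (suc i) _ (punchInᵢ≢i j k)))))) ⟩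
      _ ∎
      where s = sign R (toℕ j)
    ... | no j≢r = begin
      (s * N zero j) * det R (minor N j)
        ≈⟨ *-congˡ (det-linear-column (punchOut j≢r) a
             (λ i k k≢ → hM (suc i) _ (avoid k k≢)) (λ i k k≢ → hM′ (suc i) _ (avoid k k≢)) hr′) ⟩
      (s * N zero j) * (det R (minor M j) + a * det R (minor M′ j))
        ≈⟨ distribˡ _ _ _ ⟩
      (s * N zero j) * det R (minor M j) + (s * N zero j) * (a * det R (minor M′ j))
        ≈⟨ +-cong (*-congʳ (*-congˡ (hM zero j j≢r)))
                  (trans (x*yz≈y*xz _ a _) (*-congˡ (*-congʳ (*-congˡ (hM′ zero j j≢r))))) ⟩
      _ ∎
      where
      s = sign R (toℕ j)
      avoid : ∀ k → k ≢ punchOut j≢r → punchIn j k ≢ r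
      avoid k k≢ eq = k≢ (punchIn-injective j _ _ (≡.trans eq (≡.sym (punchIn-punchOut j≢r))))
      hr′ : ∀ i → minor N j i (punchOut j≢r) ≈ minor M j i (punchOut j≢r) + a * minor M′ j i (punchOut j≢r)
      hr′ i rewrite punchIn-punchOut j≢r = hr (suc i)

  -- Deleting a column outside the pair leaves the pair adjacent, so those minors vanish by
  -- induction. Deleting either column of the pair gives the same minor, and the signs are opposite
  -- because the positions differ by one.
  det-equal-adjacent-columns : ∀ {n} (i : Fin n) {M : Matrix (suc n)} →
    (∀ k → M k (inject₁ i) ≈ M k (suc i)) → det R M ≈ 0#
  det-equal-adjacent-columns {suc n} i {M} h = sumFin-adjacent i {f = cofactorTerm M} away pair
    where
    away : ∀ j → j ≢ inject₁ i → j ≢ suc i → cofactorTerm M j ≈ 0#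
    away j j≢p j≢r with i′ , p , r ← punchIn-avoiding-adjacent i j j≢p j≢r =
      trans (*-congˡ (det-equal-adjacent-columns i′ {M = minor M j} h′)) (zeroʳ _)
      where
      h′ : ∀ k → minor M j k (inject₁ i′) ≈ minor M j k (suc i′)
      h′ k rewrite p | r = h (suc k)
    minors : ∀ k l → minor M (inject₁ i) k l ≈ minor M (suc i) k l
    minors k l with punchIn-at-adjacent i l
    ... | inj₁ eq        = reflexive (≡.cong (M (suc k)) eq)
    ... | inj₂ (eq , eq′) rewrite eq | eq′ = sym (h (suc k))
    pair : (sign R (toℕ (inject₁ i)) * M zero (inject₁ i)) * det R (minor M (inject₁ i)) +
           (- sign R (toℕ i) * M zero (suc i)) * det R (minor M (suc i)) ≈ 0#
    pair rewrite toℕ-inject₁ i = begin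
      (s * M zero (inject₁ i)) * det R (minor M (inject₁ i)) + (- s * M zero (suc i)) * D
        ≈⟨ +-cong (*-cong (*-congˡ (h zero)) (det-cong minors))
                  (trans (*-congʳ (sym (-‿distribˡ-* _ _))) (sym (-‿distribˡ-* _ _))) ⟩
      (s * M zero (suc i)) * D + - ((s * M zero (suc i)) * D)
        ≈⟨ -‿inverseʳ _ ⟩
      0# ∎
      where
      s = sign R (toℕ i)
      D = det R (minor M (suc i))

  data Adjacent : ∀ {n} → Fin n → Fin n → Set where
    right : ∀ {n} (i : Fin n) → Adjacent (inject₁ i) (suc i)
    left  : ∀ {n} (i : Fin n) → Adjacent (suc i) (inject₁ i)

  Adjacent-≢ : ∀ {n} {p r : Fin n} → Adjacent p r → p ≢ r
  Adjacent-≢ (right i) eq = inject₁≢suc i eq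
  Adjacent-≢ (left i)  eq = inject₁≢suc i (≡.sym eq)

  shear : ∀ {n} → Fin n → Fin n → Carrier → (Fin n → Carrier) → Fin n → Carrier
  shear p r a u = updateAt u r (_+ a * u p)

  det-shear : ∀ {n} {p r : Fin n} → Adjacent p r → ∀ a (M : Matrix n) →
    det R (λ i → shear p r a (M i)) ≈ det R M
  det-shear {n} {p} {r} p~r a M = begin
    det R (λ i → shear p r a (M i))
      ≈⟨ det-linear-column r a
           (λ i k k≢r → reflexive (updateAt-minimal k r (M i) k≢r))
           (λ i k k≢r → reflexive (≡.trans (updateAt-minimal k r (M i) k≢r)
                                           (≡.sym (updateAt-minimal k r (M i) k≢r))))
           (λ i → reflexive (≡.trans (updateAt-updates r (M i))
                                     (≡.cong (λ t → M i r + a * t) (≡.sym (updateAt-updates r (M i)))))) ⟩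
    det R M + a * det R copy ≈⟨ +-congˡ (trans (*-congˡ (det-copy p~r columns)) (zeroʳ a)) ⟩
    det R M + 0#             ≈⟨ +-identityʳ _ ⟩
    det R M                  ∎
    where
    -- The sheared matrix arises from M by adding a times column r of this one, which repeats column
    -- p there.
    copy : Matrix n
    copy i = updateAt (M i) r (λ _ → M i p)
    columns : ∀ i → copy i p ≈ copy i r
    columns i = reflexive (≡.trans (updateAt-minimal p r (M i) (Adjacent-≢ p~r))
                                   (≡.sym (updateAt-updates r (M i))))
    det-copy : ∀ {n} {p r : Fin n} {N : Matrix n} → Adjacent p r → (∀ i → N i p ≈ N i r) → det R N ≈ 0#
    det-copy {N = N} (right i) h = det-equal-adjacent-columns i {M = N} h
    det-copy {N = N} (left i)  h = det-equal-adjacent-columns i {M = N} (λ k → sym (h k))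

-- Ring solver with integer coefficients

module IntegerCoefficients {c ℓ} (R : CommutativeRing c ℓ) where

  open CommutativeRing R hiding (zero)
  open import Data.Integer.Base using (+_)
  open import Algebra.Properties.Ring ring
    using (-‿distribˡ-*; -‿distribʳ-*; -‿involutive; -0#≈0#)
  open import Algebra.Properties.AbelianGroup +-abelianGroup using (⁻¹-∙-comm)
  -- With this variant 1 · 1# reduces to 1#, so that the solver can treat 1# as a constant.
  open import Algebra.Properties.Semiring.Mult.TCOptimised semiring 
    using (1+×; ×-homo-+; ×1-homo-*) renaming (_×_ to _·_)
  open import Algebra.Properties.CommutativeSemigroup +-commutativeSemigroup using (interchange)
  open import Relation.Binary.Reasoning.Setoid setoid

  ι : ℤ → Carrier
  ι (+ n)    = n · 1#
  ι -[1+ n ] = - (suc n · 1#)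

  ι-⊖ : ∀ m n → ι (m ⊖ n) ≈ m · 1# + - (n · 1#)
  ι-⊖ m       zero    = sym (trans (+-congˡ -0#≈0#) (+-identityʳ _))
  ι-⊖ zero    (suc n) = sym (+-identityˡ _)
  ι-⊖ (suc m) (suc n) = begin
    ι (suc m ⊖ suc n)                         ≡⟨ ≡.cong ι (ℤ.[1+m]⊖[1+n]≡m⊖n m n) ⟩
    ι (m ⊖ n)                                 ≈⟨ ι-⊖ m n ⟩
    m · 1# + - (n · 1#)                       ≈⟨ +-identityˡ _ ⟨
    0# + (m · 1# + - (n · 1#))                ≈⟨ +-congʳ (-‿inverseʳ 1#) ⟨
    (1# + - 1#) + (m · 1# + - (n · 1#))       ≈⟨ interchange _ _ _ _ ⟩
    (1# + m · 1#) + (- 1# + - (n · 1#))       ≈⟨ +-congˡ (⁻¹-∙-comm _ _) ⟩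
    (1# + m · 1#) + - (1# + n · 1#)           ≈⟨ +-cong (1+× m 1#) (-‿cong (1+× n 1#)) ⟨
    suc m · 1# + - (suc n · 1#)               ∎

  ι-+ : ∀ i j → ι (i ℤ.+ j) ≈ ι i + ι j
  ι-+ (+ m)    (+ n)    = ×-homo-+ 1# m n
  ι-+ (+ m)    -[1+ n ] = ι-⊖ m (suc n)
  ι-+ -[1+ m ] (+ n)    = trans (ι-⊖ n (suc m)) (+-comm _ _)
  ι-+ -[1+ m ] -[1+ n ] = begin
    - (suc (suc (m ℕ.+ n)) · 1#)          ≡⟨ ≡.cong (λ k → - (k · 1#)) (ℕ.+-suc (suc m) n) ⟨
    - ((suc m ℕ.+ suc n) · 1#)            ≈⟨ -‿cong (×-homo-+ 1# (suc m) (suc n)) ⟩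
    - (suc m · 1# + suc n · 1#)           ≈⟨ ⁻¹-∙-comm _ _ ⟨
    - (suc m · 1#) + - (suc n · 1#)       ∎

  ι-neg : ∀ i → ι (ℤ.- i) ≈ - ι i
  ι-neg (+ zero)  = sym -0#≈0#
  ι-neg (+ suc n) = refl
  ι-neg -[1+ n ]  = sym (-‿involutive _)

  ι-neg◃ : ∀ n → ι (Sign.- ◃ n) ≈ - (n · 1#)
  ι-neg◃ zero    = sym -0#≈0#
  ι-neg◃ (suc n) = refl

  ι-pos◃ : ∀ n → ι (Sign.+ ◃ n) ≈ n · 1#
  ι-pos◃ zero    = refl
  ι-pos◃ (suc n) = refl

  ι-* : ∀ i j → ι (i ℤ.* j) ≈ ι i * ι j
  ι-* (+ m)    (+ n)    = trans (ι-pos◃ (m ℕ.* n)) (×1-homo-* m n)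
  ι-* (+ m)    -[1+ n ] = trans (ι-neg◃ (m ℕ.* suc n)) (trans (-‿cong (×1-homo-* m (suc n))) (-‿distribʳ-* _ _))
  ι-* -[1+ m ] (+ n)    = trans (ι-neg◃ (suc m ℕ.* n)) (trans (-‿cong (×1-homo-* (suc m) n)) (-‿distribˡ-* _ _))
  ι-* -[1+ m ] -[1+ n ] = begin
    ι (Sign.+ ◃ (suc m ℕ.* suc n))            ≈⟨ ι-pos◃ (suc m ℕ.* suc n) ⟩
    (suc m ℕ.* suc n) · 1#                    ≈⟨ ×1-homo-* (suc m) (suc n) ⟩
    (suc m · 1#) * (suc n · 1#)               ≈⟨ -‿involutive _ ⟨
    - - ((suc m · 1#) * (suc n · 1#))         ≈⟨ -‿cong (-‿distribʳ-* _ _) ⟩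
    - ((suc m · 1#) * - (suc n · 1#))         ≈⟨ -‿distribˡ-* _ _ ⟩
    - (suc m · 1#) * - (suc n · 1#)           ∎

  ι-morphism : ℤ.+-*-rawRing -Raw-AlmostCommutative⟶ fromCommutativeRing R
  ι-morphism = record
    { ⟦_⟧    = ι
    ; +-homo = ι-+
    ; *-homo = ι-*
    ; -‿homo = ι-neg
    ; 0-homo = refl
    ; 1-homo = refl
    }

  -- Only a sufficient test, since distinct integers may agree in the ring. The identities solved
  -- below hold over the integers, so comparing integers is enough to see that their terms cancel.
  ι-≟ : ∀ i j → Maybe.Maybe (ι i ≈ ι j)
  ι-≟ i j = Maybe.map (λ i≡j → reflexive (≡.cong ι i≡j)) (dec⇒maybe (i ℤ.≟ j))

  module Solver = Algebra.Solver.Ring ℤ.+-*-rawRing (fromCommutativeRing R) ι-morphism ι-≟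

-- Counting in finite types

open import Data.Bool using (if_then_else_)
open import Data.List using (List; []; _∷_; length; allFin; cartesianProductWith; filter)
import Data.List as List
open import Data.List.Extrema ℕ.≤-totalOrder using (argmin; argmin-all; f[argmin]≤f[xs])
open import Data.List.Membership.Propositional using (_∈_; lose)
open import Data.List.Membership.Propositional.Properties
  using (∈-allFin; ∈-lookup; ∈-filter⁺; ∈-cartesianProductWith⁺)
open import Data.List.Properties using (length-++; length-map; length-tabulate)
open import Data.List.Relation.Unary.All using (All; []; _∷_)
import Data.List.Relation.Unary.All as All
open import Data.List.Relation.Unary.All.Properties using (all-filter)
open import Data.List.Relation.Unary.AllPairs using (AllPairs; []; _∷_)
open import Data.List.Relation.Unary.Any using (here; there; any?; satisfied)
open import Data.List.Relation.Unary.Unique.Propositional using (Unique)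
import Data.List.Relation.Unary.Unique.Propositional.Properties as Unique
open import Data.Nat using (_+_; _*_; _^_; _∸_; _≤_; _<_; z≤n; s≤s; NonZero; >-nonZero)
open import Data.Nat.Properties hiding (_≟_; suc-injective)
open import Data.Nat.Solver using (module +-*-Solver)
open import Relation.Binary.PropositionalEquality hiding ([_])

infix 6 [_]

-- Sets are decidable predicates, and a sum over a set is a sum over the whole type weighted by this
-- indicator. Every double count is then an exchange of two sums of natural numbers.
[_] : ∀ {p} {P : Set p} → Dec P → ℕ
[ d ] = if does d then 1 else 0

module _ {p} {P : Set p} where

  [_]≡1 : (d : Dec P) → P → [ d ] ≡ 1
  [ yes _ ]≡1 _ = refl
  [ no ¬p ]≡1 p = contradiction p ¬p

  [_]≡0 : (d : Dec P) → ¬ P → [ d ] ≡ 0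
  [ yes p ]≡0 ¬p = contradiction p ¬p
  [ no _ ]≡0 _ = refl

  []*-mono : (d : Dec P) {m n : ℕ} → (P → m ≤ n) → [ d ] * m ≤ [ d ] * n
  []*-mono (yes p) f = *-monoʳ-≤ 1 (f p)
  []*-mono (no _)  f = z≤n

  []*≤ : (d : Dec P) {m n : ℕ} → (P → m ≤ n) → [ d ] * m ≤ n
  []*≤ (yes p) {m} f = ≤-trans (≤-reflexive (+-identityʳ m)) (f p)
  []*≤ (no _)  f = z≤n

[]-mono : ∀ {p r} {P : Set p} {Q : Set r} (d : Dec P) (e : Dec Q) → (P → Q) → [ d ] ≤ [ e ]
[]-mono (yes p) e f = ≤-reflexive (sym ([ e ]≡1 (f p)))
[]-mono (no _)  e f = z≤n

module _ {a} {X : Set a} where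

  ∑ : List X → (X → ℕ) → ℕ
  ∑ []       f = 0
  ∑ (x ∷ xs) f = f x + ∑ xs f

  syntax ∑ xs (λ x → t) = ∑[ x ∈ xs ] t

  ∑-mono : ∀ xs {f g : X → ℕ} → (∀ x → f x ≤ g x) → ∑ xs f ≤ ∑ xs g
  ∑-mono []       h = z≤n
  ∑-mono (x ∷ xs) h = +-mono-≤ (h x) (∑-mono xs h)

  ∑-cong : ∀ xs {f g : X → ℕ} → (∀ x → f x ≡ g x) → ∑ xs f ≡ ∑ xs g
  ∑-cong []       h = refl
  ∑-cong (x ∷ xs) h = cong₂ _+_ (h x) (∑-cong xs h)

  ∑-+ : ∀ xs (f g : X → ℕ) → ∑[ x ∈ xs ] (f x + g x) ≡ ∑ xs f + ∑ xs g
  ∑-+ []       f g = refl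
  ∑-+ (x ∷ xs) f g rewrite ∑-+ xs f g =
    solve 4 (λ a b c d → (a :+ b) :+ (c :+ d) := (a :+ c) :+ (b :+ d)) refl (f x) (g x) (∑ xs f) (∑ xs g)
    where open +-*-Solver

  ∑-*ˡ : ∀ xs c (f : X → ℕ) → ∑[ x ∈ xs ] (c * f x) ≡ c * ∑ xs f
  ∑-*ˡ []       c f = sym (*-zeroʳ c)
  ∑-*ˡ (x ∷ xs) c f rewrite ∑-*ˡ xs c f = sym (*-distribˡ-+ c (f x) _)

  ∑-*ʳ : ∀ xs c (f : X → ℕ) → ∑[ x ∈ xs ] (f x * c) ≡ ∑ xs f * c
  ∑-*ʳ xs c f = trans (∑-cong xs (λ x → *-comm (f x) c)) (trans (∑-*ˡ xs c f) (*-comm c _))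

  ∑-const : ∀ xs c → ∑[ x ∈ xs ] c ≡ length xs * c
  ∑-const []       c = refl
  ∑-const (x ∷ xs) c = cong (c +_) (∑-const xs c)

  ∑-zero : ∀ xs {f : X → ℕ} → (∀ x → f x ≡ 0) → ∑ xs f ≡ 0
  ∑-zero xs h = trans (∑-cong xs h) (trans (∑-const xs 0) (*-zeroʳ (length xs)))

  ≤-∑ : ∀ {x xs} (f : X → ℕ) → x ∈ xs → f x ≤ ∑ xs f
  ≤-∑ f (here refl) = m≤m+n _ _
  ≤-∑ f (there x∈)  = ≤-trans (≤-∑ f x∈) (m≤n+m _ _)

∑-swap : ∀ {a b} {X : Set a} {Y : Set b} xs ys (f : X → Y → ℕ) →
         ∑[ x ∈ xs ] ∑[ y ∈ ys ] f x y ≡ ∑[ y ∈ ys ] ∑[ x ∈ xs ] f x y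
∑-swap []       ys f = sym (∑-zero ys (λ _ → refl))
∑-swap (x ∷ xs) ys f rewrite ∑-swap xs ys f = sym (∑-+ ys (f x) _)

module _ {a p} {X : Set a} {P : X → Set p} (P? : Decidable P) where

  count : List X → ℕ
  count xs = ∑[ x ∈ xs ] [ P? x ]

  private
    count-none : ∀ xs → All (λ x → ¬ P x) xs → count xs ≡ 0
    count-none []       _ = refl
    count-none (x ∷ xs) (¬p All.∷ ¬ps) rewrite [ P? x ]≡0 ¬p = count-none xs ¬ps

  count-subsingleton : ∀ {xs} → Unique xs → (∀ {x y} → P x → P y → x ≡ y) → count xs ≤ 1
  count-subsingleton []         _ = z≤n
  count-subsingleton {x ∷ xs} (x∉ ∷ u) h with P? x
  ... | yes px = ≤-reflexive (cong suc (count-none xs (All.map (λ x≢y py → x≢y (h px py)) x∉)))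
  ... | no _   = count-subsingleton u h

record Finite {a} (X : Set a) : Set a where
  field
    elements : List X
    unique   : Unique elements
    complete : ∀ x → x ∈ elements

  size : ℕ
  size = length elements

  ∃? : ∀ {p} {P : X → Set p} → Decidable P → Dec (∃ P)
  ∃? P? = map′ satisfied (λ (x , px) → lose (complete x) px) (any? P? elements)

  # : ∀ {p} {P : X → Set p} → Decidable P → ℕ
  # P? = count P? elements

open Finite

module _ {a b} {X : Set a} {Y : Set b} (𝕏 : Finite X) (𝕐 : Finite Y) (_≟_ : DecidableEquality Y) where

  private
    xs = elements 𝕏
    ys = elements 𝕐

  -- Count the pairs (x, f x): each x in `P` supplies at least one of them, while each y receives at
  -- most k, and none outside `Q`.
  #≤fibre*# : ∀ {p r} {P : X → Set p} {Q : Y → Set r} (P? : Decidable P) (Q? : Decidable Q)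
              (f : X → Y) k → (∀ {x} → P x → Q (f x)) →
              (∀ y → # 𝕏 (λ x → P? x ×-dec (f x ≟ y)) ≤ k) →
              # 𝕏 P? ≤ k * # 𝕐 Q?
  #≤fibre*# {P = P} {Q} P? Q? f k f-maps fibre = begin
    # 𝕏 P?                                              ≤⟨ ∑-mono xs spread ⟩
    ∑[ x ∈ xs ] ∑[ y ∈ ys ] [ P? x ×-dec (f x ≟ y) ]    ≡⟨ ∑-swap xs ys _ ⟩
    ∑[ y ∈ ys ] # 𝕏 (λ x → P? x ×-dec (f x ≟ y))         ≤⟨ ∑-mono ys collect ⟩
    ∑[ y ∈ ys ] (k * [ Q? y ])                          ≡⟨ ∑-*ˡ ys k _ ⟩
    k * # 𝕐 Q?                                          ∎
    where
    open ≤-Reasoning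
    spread : ∀ x → [ P? x ] ≤ ∑[ y ∈ ys ] [ P? x ×-dec (f x ≟ y) ]
    spread x = ≤-trans ([]-mono (P? x) (P? x ×-dec (f x ≟ f x)) (_, refl))
                       (≤-∑ (λ y → [ P? x ×-dec (f x ≟ y) ]) (complete 𝕐 (f x)))
    collect : ∀ y → # 𝕏 (λ x → P? x ×-dec (f x ≟ y)) ≤ k * [ Q? y ]
    collect y with Q? y
    ... | yes _ = ≤-trans (fibre y) (≤-reflexive (sym (*-identityʳ k)))
    ... | no ¬q = ≤-trans (≤-reflexive (∑-zero xs λ x → [ P? x ×-dec (f x ≟ y) ]≡0
                    (λ (px , eq) → ¬q (subst Q eq (f-maps px))))) z≤n

  #-injective : ∀ {p r} {P : X → Set p} {Q : Y → Set r} (P? : Decidable P) (Q? : Decidable Q)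
                (f : X → Y) → (∀ {x} → P x → Q (f x)) →
                (∀ {x x′} → P x → P x′ → f x ≡ f x′ → x ≡ x′) →
                # 𝕏 P? ≤ # 𝕐 Q?
  #-injective P? Q? f f-maps f-inj = ≤-trans
    (#≤fibre*# P? Q? f 1 f-maps λ y → count-subsingleton (λ x → P? x ×-dec (f x ≟ y)) (unique 𝕏)
      (λ (px , fx≡y) (px′ , fx′≡y) → f-inj px px′ (trans fx≡y (sym fx′≡y))))
    (≤-reflexive (+-identityʳ _))

length-cartesianProductWith : ∀ {a b c} {X : Set a} {Y : Set b} {Z : Set c} (f : X → Y → Z) xs ys →
  length (cartesianProductWith f xs ys) ≡ length xs * length ys
length-cartesianProductWith f []       ys = refl
length-cartesianProductWith f (x ∷ xs) ys = trans (length-++ (List.map (f x) ys))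
  (cong₂ _+_ (length-map (f x) ys) (length-cartesianProductWith f xs ys))

∑-product : ∀ {a b} {X : Set a} {Y : Set b} xs ys (f : X → ℕ) (g : Y → ℕ) →
            ∑ xs f * ∑ ys g ≡ ∑[ x ∈ xs ] ∑[ y ∈ ys ] (f x * g y)
∑-product xs ys f g = trans (sym (∑-*ʳ xs (∑ ys g) f)) (∑-cong xs (λ x → sym (∑-*ˡ ys (f x) g)))

[]-× : ∀ {p r} {P : Set p} {Q : Set r} (d : Dec P) (e : Dec Q) → [ d ×-dec e ] ≡ [ d ] * [ e ]
[]-× (yes _) (yes _) = refl
[]-× (yes _) (no _)  = refl
[]-× (no _)  e       = refl

module _ {a} {X : Set a} (𝕏 : Finite X) where

  private xs = elements 𝕏

  #-mono : ∀ {p r} {P : X → Set p} {Q : X → Set r} (P? : Decidable P) (Q? : Decidable Q) →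
           (∀ {x} → P x → Q x) → # 𝕏 P? ≤ # 𝕏 Q?
  #-mono P? Q? h = ∑-mono xs (λ x → []-mono (P? x) (Q? x) h)

  #-none : ∀ {p} {P : X → Set p} (P? : Decidable P) → (∀ x → ¬ P x) → # 𝕏 P? ≡ 0
  #-none P? h = ∑-zero xs (λ x → [ P? x ]≡0 (h x))

  #-subsingleton : ∀ {p} {P : X → Set p} (P? : Decidable P) →
                   (∀ {x y} → P x → P y → x ≡ y) → # 𝕏 P? ≤ 1
  #-subsingleton P? = count-subsingleton P? (unique 𝕏)

  #-×ˡ : ∀ {p r} {P : Set p} {Q : X → Set r} (d : Dec P) (Q? : Decidable Q) →
         # 𝕏 (λ x → d ×-dec Q? x) ≡ [ d ] * # 𝕏 Q?
  #-×ˡ d Q? = trans (∑-cong xs (λ x → []-× d (Q? x))) (∑-*ˡ xs [ d ] _)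

  minimiser : ∀ {p} {P : X → Set p} (P? : Decidable P) (f : X → ℕ) {x} → P x →
              ∃ λ y → P y × (∀ {z} → P z → f y ≤ f z)
  -- The default `x` satisfies `P` itself, so the result does so whether or not a candidate beats
  -- it.
  minimiser P? f {x} Px = argmin f x candidates ,
    argmin-all f Px (all-filter P? xs) ,
    λ {z} Pz → All.lookup (f[argmin]≤f[xs] x candidates) (∈-filter⁺ P? (complete 𝕏 z) Pz)
    where
    candidates = filter P? xs

-- Inequalities between natural numbers

2mn≤m²+n² : ∀ m n → 2 * (m * n) ≤ m * m + n * n
2mn≤m²+n² m n = [ ordered , (λ n≤m → subst₂ _≤_ (cong (2 *_) (*-comm n m)) (+-comm (n * n) (m * m)) (ordered n≤m)) ]′
  (≤-total m n)
  where
  open +-*-Solver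
  ordered : ∀ {m n} → m ≤ n → 2 * (m * n) ≤ m * m + n * n
  -- With n = m + k the two sides differ by k².
  ordered {m} {n} m≤n = subst (λ n → 2 * (m * n) ≤ m * m + n * n) (m+[n∸m]≡n m≤n)
    (≤-trans (m≤m+n _ ((n ∸ m) * (n ∸ m))) (≤-reflexive (solve 2 (λ m k →
      con 2 :* (m :* (m :+ k)) :+ k :* k := m :* m :+ (m :+ k) :* (m :+ k)) refl m (n ∸ m))))

-- S and T stand for the first and second moments, over all planes, of their numbers of points of E.
missed-planes-arithmetic : ∀ q N B S T → 1 ≤ N → q ≤ 2 * N → q ^ 2 * N ≤ S → T ≤ q * (N * N) + S →
  2 * (N * (q * S)) + N * N * B ≤ q ^ 3 * (N * N) + q * q * T → N * B ≤ q ^ 4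
missed-planes-arithmetic q N@(suc _) B S T 1≤N q≤2N S≥ T≤ h = *-cancelˡ-≤ N (+-cancelˡ-≤ C _ _ (begin
  C + N * (N * B)                                                        ≡⟨ regroup q N B δ ⟩
  2 * (N * (q * (q ^ 2 * N + δ))) + N * N * B
    ≡⟨ cong (λ S → 2 * (N * (q * S)) + N * N * B) S≡ ⟩
  2 * (N * (q * S)) + N * N * B                                          ≤⟨ h ⟩
  q ^ 3 * (N * N) + q * q * T
    ≤⟨ +-monoʳ-≤ (q ^ 3 * (N * N)) (*-monoʳ-≤ (q * q) T≤) ⟩
  q ^ 3 * (N * N) + q * q * (q * (N * N) + S)
    ≡⟨ cong (λ S → q ^ 3 * (N * N) + q * q * (q * (N * N) + S)) S≡ ⟨
  q ^ 3 * (N * N) + q * q * (q * (N * N) + (q ^ 2 * N + δ))              ≡⟨ expand q N δ ⟩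
  2 * (q ^ 3 * (N * N)) + N * q ^ 4 + q * (q * δ)
    ≤⟨ +-monoʳ-≤ (2 * (q ^ 3 * (N * N)) + N * q ^ 4) (*-monoʳ-≤ q (*-monoˡ-≤ δ q≤2N)) ⟩
  2 * (q ^ 3 * (N * N)) + N * q ^ 4 + q * (2 * N * δ)                    ≡⟨ collect q N δ ⟩
  C + N * q ^ 4                                                          ∎))
  where
  open ≤-Reasoning
  open +-*-Solver
  -- This excess has coefficient 2qN on the left and q² on the right, so `q ≤ 2 * N` lets it cancel
  -- and a lower bound for `S` suffices.
  δ = S ∸ q ^ 2 * N
  S≡ : q ^ 2 * N + δ ≡ S
  S≡ = m+[n∸m]≡n S≥
  C = 2 * (q ^ 3 * (N * N)) + q * (2 * N * δ)
  regroup : ∀ q N B δ → 2 * (q ^ 3 * (N * N)) + q * (2 * N * δ) + N * (N * B) ≡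
    2 * (N * (q * (q ^ 2 * N + δ))) + N * N * B
  regroup = solve 4 (λ q N B δ → con 2 :* (q :^ 3 :* (N :* N)) :+ q :* (con 2 :* N :* δ) :+ N :* (N :* B) :=
    con 2 :* (N :* (q :* (q :^ 2 :* N :+ δ))) :+ N :* N :* B) refl
  expand : ∀ q N δ → q ^ 3 * (N * N) + q * q * (q * (N * N) + (q ^ 2 * N + δ)) ≡
    2 * (q ^ 3 * (N * N)) + N * q ^ 4 + q * (q * δ)
  expand = solve 3 (λ q N δ → q :^ 3 :* (N :* N) :+ q :* q :* (q :* (N :* N) :+ (q :^ 2 :* N :+ δ)) :=
    con 2 :* (q :^ 3 :* (N :* N)) :+ N :* q :^ 4 :+ q :* (q :* δ)) refl
  collect : ∀ q N δ → 2 * (q ^ 3 * (N * N)) + N * q ^ 4 + q * (2 * N * δ) ≡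
    2 * (q ^ 3 * (N * N)) + q * (2 * N * δ) + N * q ^ 4
  collect = solve 3 (λ q N δ → con 2 :* (q :^ 3 :* (N :* N)) :+ N :* q :^ 4 :+ q :* (con 2 :* N :* δ) :=
    con 2 :* (q :^ 3 :* (N :* N)) :+ q :* (con 2 :* N :* δ) :+ N :* q :^ 4) refl

-- Since r is at least 2q, the terms q N + r q take up at most half of N r + r², which leaves N + r
-- ≤ 2B. Then N (N + 1) ≤ 2 N B ≤ 2q⁴, and N + 1 ≥ 2q² forces N ≤ q², which is too small.
bounds-incompatible : ∀ q N B r → 2 ≤ q → 2 * q ^ 2 ≤ suc N → N ≤ q * r →
  N * r + r * r ≤ r * B + (q * N + r * q) → ¬ (N * B ≤ q ^ 4)
bounds-incompatible q@(suc _) N B r 2≤q N-large N≤qr lines NB≤q⁴ = <⇒≱ M<2M-1 (≤-trans N-large (s≤s N≤M))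
  where
  open ≤-Reasoning
  open +-*-Solver
  M = q ^ 2
  2≤M : 2 ≤ M
  2≤M = ≤-trans 2≤q (≤-trans (m≤m*n q q) (≤-reflexive (cong (q *_) (sym (*-identityʳ q)))))
  M<2M-1 : suc M < 2 * M
  M<2M-1 = +-mono-≤ 2≤M (m≤m+n M 0)
  2q≤r : 2 * q ≤ r
  -- Rounding absorbs the off-by-one: r ≤ 2q - 1 would give q r ≤ 2q² - q, but q r is at least 2q² -
  -- 1.
  2q≤r = ≮⇒≥ λ r<2q → <⇒≱ 2≤q (+-cancelʳ-≤ (q * r) q 1 (begin
    q + q * r     ≡⟨ *-suc q r ⟨
    q * suc r     ≤⟨ *-monoʳ-≤ q r<2q ⟩
    q * (2 * q)   ≡⟨ solve 1 (λ q → q :* (con 2 :* q) := con 2 :* q :^ 2) refl q ⟩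
    2 * q ^ 2     ≤⟨ N-large ⟩
    suc N         ≤⟨ s≤s N≤qr ⟩
    1 + q * r     ∎))
  r≢0 : NonZero r
  r≢0 = >-nonZero (≤-trans (s≤s z≤n) 2q≤r)
  N+r≤2B : N + r ≤ 2 * B
  N+r≤2B = *-cancelˡ-≤ r {{r≢0}} (+-cancelʳ-≤ (N * r + r * r) _ _ (begin
    r * (N + r) + (N * r + r * r)
      ≡⟨ solve 2 (λ N r → r :* (N :+ r) :+ (N :* r :+ r :* r) := con 2 :* (N :* r :+ r :* r)) refl N r ⟩
    2 * (N * r + r * r)                            ≤⟨ *-monoʳ-≤ 2 lines ⟩
    2 * (r * B + (q * N + r * q))
      ≡⟨ solve 4 (λ q N B r → con 2 :* (r :* B :+ (q :* N :+ r :* q)) :=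
           r :* (con 2 :* B) :+ (N :* (con 2 :* q) :+ r :* (con 2 :* q))) refl q N B r ⟩
    r * (2 * B) + (N * (2 * q) + r * (2 * q))
      ≤⟨ +-monoʳ-≤ (r * (2 * B)) (+-mono-≤ (*-monoʳ-≤ N 2q≤r) (*-monoʳ-≤ r 2q≤r)) ⟩
    r * (2 * B) + (N * r + r * r)                  ∎))
  N≤M : N ≤ M
  N≤M = *-cancelʳ-≤ N M (2 * M) {{m*n≢0 2 M {{_}} {{m^n≢0 q 2}}}} (begin
    N * (2 * M)     ≤⟨ *-monoʳ-≤ N N-large ⟩
    N * suc N       ≤⟨ *-monoʳ-≤ N (≤-trans (≤-reflexive (+-comm 1 N)) (+-monoʳ-≤ N (≤-trans (s≤s z≤n) 2q≤r))) ⟩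
    N * (N + r)     ≤⟨ *-monoʳ-≤ N N+r≤2B ⟩
    N * (2 * B)     ≡⟨ solve 2 (λ N B → N :* (con 2 :* B) := con 2 :* (N :* B)) refl N B ⟩
    2 * (N * B)     ≤⟨ *-monoʳ-≤ 2 NB≤q⁴ ⟩
    2 * q ^ 4       ≡⟨ solve 1 (λ q → con 2 :* q :^ 4 := q :^ 2 :* (con 2 :* q :^ 2)) refl q ⟩
    M * (2 * M)     ∎)

-- Geometry of a finite field with carrier Fin q

open import Data.Vec using (Vec; []; _∷_; tabulate; zipWith; replicate)
import Data.Vec as Vec
open import Data.Vec.Properties using (∷-injective; ≡-dec; tabulate∘lookup; lookup∘tabulate; tabulate-cong)

module FiniteField {q} {add mul : Op₂ (Fin q)} {neg : Op₁ (Fin q)} {0# 1# : Fin q}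
  (isCommutativeRing : IsCommutativeRing _≡_ add mul neg 0# 1#)
  (1≢0 : 1# ≢ 0#) (inverse : ∀ x → x ≢ 0# → ∃ λ y → mul x y ≡ 1#) where

  open import Data.Vec using (lookup)

  𝔽 : CommutativeRing 0ℓ 0ℓ
  𝔽 = record { isCommutativeRing = isCommutativeRing }

  private
    A = Fin q
    module 𝔽 = CommutativeRing 𝔽
    variable n : ℕ
  open 𝔽 using () renaming
    (_+_ to infixl 6 _⊕_; _*_ to infixl 7 _⊗_; -_ to infix 8 ⊖_; 0# to 𝟘; 1# to 𝟙)
  open IntegerCoefficients 𝔽 using (module Solver)
  open Determinant 𝔽
  open import Algebra.Properties.Ring 𝔽.ring using (+-cancelˡ; +-cancelʳ; -‿injective)
  open import Algebra.Properties.CommutativeSemigroup 𝔽.+-commutativeSemigroup using (x∙yz≈y∙xz; x∙yz≈z∙xy)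

  ⊗-cancelˡ : ∀ {x} → x ≢ 𝟘 → ∀ {a b} → x ⊗ a ≡ x ⊗ b → a ≡ b
  ⊗-cancelˡ {x} x≢0 {a} {b} eq with y , xy≡1 ← inverse x x≢0 =
    trans (sym (undo a)) (trans (cong (y ⊗_) eq) (undo b))
    where
    undo : ∀ c → y ⊗ (x ⊗ c) ≡ c
    undo c = trans (sym (𝔽.*-assoc y x c)) (trans (cong (_⊗ c) (trans (𝔽.*-comm y x) xy≡1)) (𝔽.*-identityˡ c))

  infixl 6 _⊝_
  _⊝_ : Op₂ A
  x ⊝ y = x ⊕ ⊖ y

  ⊝-cancelˡ : ∀ a {b c} → a ⊝ b ≡ a ⊝ c → b ≡ c
  ⊝-cancelˡ a eq = -‿injective (+-cancelˡ a _ _ eq)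

  ⊝-cancelʳ : ∀ a {b c} → b ⊝ a ≡ c ⊝ a → b ≡ c
  ⊝-cancelʳ a eq = +-cancelʳ (⊖ a) _ _ eq

  𝟎 : Vec A n
  𝟎 = replicate _ 𝟘

  scale : A → Vec A n → Vec A n
  scale a = Vec.map (a ⊗_)

  infixl 6 _-ᵛ_
  _-ᵛ_ : Vec A n → Vec A n → Vec A n
  _-ᵛ_ = zipWith _⊝_

  scale-cancel-ᵛ : ∀ {a} → a ≢ 𝟘 → (u : Vec A n) {v w : Vec A n} → scale a v -ᵛ u ≡ scale a w -ᵛ u → v ≡ w
  scale-cancel-ᵛ a≢0 []      {[]}    {[]}    eq = refl
  scale-cancel-ᵛ a≢0 (t ∷ u) {x ∷ v} {y ∷ w} eq with hd , tl ← ∷-injective eq =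
    cong₂ _∷_ (⊗-cancelˡ a≢0 (⊝-cancelʳ t hd)) (scale-cancel-ᵛ a≢0 u tl)

  v-v≡𝟎 : (v : Vec A n) → v -ᵛ v ≡ 𝟎
  v-v≡𝟎 []      = refl
  v-v≡𝟎 (x ∷ v) = cong₂ _∷_ (𝔽.-‿inverseʳ x) (v-v≡𝟎 v)

  _≟ᵛ_ : (u v : Vec A n) → Dec (u ≡ v)
  _≟ᵛ_ = ≡-dec _≟_

  dot : Vec A 3 → Vec A 3 → A
  dot (x₀ ∷ x₁ ∷ x₂ ∷ []) (y₀ ∷ y₁ ∷ y₂ ∷ []) = x₀ ⊗ y₀ ⊕ (x₁ ⊗ y₁ ⊕ x₂ ⊗ y₂)

  cross : Vec A 3 → Vec A 3 → Vec A 3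
  cross (x₀ ∷ x₁ ∷ x₂ ∷ []) (y₀ ∷ y₁ ∷ y₂ ∷ []) =
    (x₁ ⊗ y₂ ⊝ x₂ ⊗ y₁) ∷ (x₂ ⊗ y₀ ⊝ x₀ ⊗ y₂) ∷ (x₀ ⊗ y₁ ⊝ x₁ ⊗ y₀) ∷ []

  private
    cross-cross₀ : ∀ x₀ x₁ x₂ z₀ z₁ z₂ w₀ w₁ w₂ →
      (x₂ ⊗ z₀ ⊝ x₀ ⊗ z₂) ⊗ w₂ ⊝ (x₀ ⊗ z₁ ⊝ x₁ ⊗ z₀) ⊗ w₁ ≡
      (x₀ ⊗ w₀ ⊕ (x₁ ⊗ w₁ ⊕ x₂ ⊗ w₂)) ⊗ z₀ ⊝ (z₀ ⊗ w₀ ⊕ (z₁ ⊗ w₁ ⊕ z₂ ⊗ w₂)) ⊗ x₀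
    cross-cross₀ = solve 9 (λ x₀ x₁ x₂ z₀ z₁ z₂ w₀ w₁ w₂ →
      (x₂ :* z₀ :- x₀ :* z₂) :* w₂ :- (x₀ :* z₁ :- x₁ :* z₀) :* w₁ :=
      (x₀ :* w₀ :+ (x₁ :* w₁ :+ x₂ :* w₂)) :* z₀ :- (z₀ :* w₀ :+ (z₁ :* w₁ :+ z₂ :* w₂)) :* x₀) refl
      where open Solver

    rotate-sum : ∀ a b c → b ⊕ (c ⊕ a) ≡ a ⊕ (b ⊕ c)
    rotate-sum = solve 3 (λ a b c → b :+ (c :+ a) := a :+ (b :+ c)) refl
      where open Solver

    dot-rotate : ∀ x₀ x₁ x₂ y₀ y₁ y₂ →
      dot (x₁ ∷ x₂ ∷ x₀ ∷ []) (y₁ ∷ y₂ ∷ y₀ ∷ []) ≡ dot (x₀ ∷ x₁ ∷ x₂ ∷ []) (y₀ ∷ y₁ ∷ y₂ ∷ [])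
    dot-rotate x₀ x₁ x₂ y₀ y₁ y₂ = rotate-sum (x₀ ⊗ y₀) (x₁ ⊗ y₁) (x₂ ⊗ y₂)

  -- The vector triple product formula. `cross-cross₀` is its first coordinate, and cyclic rotation
  -- of the indices gives the others. It serves to recover z from x × z and to intersect planes.
  cross-cross : ∀ x z w → cross (cross x z) w ≡ scale (dot x w) z -ᵛ scale (dot z w) x
  cross-cross (x₀ ∷ x₁ ∷ x₂ ∷ []) (z₀ ∷ z₁ ∷ z₂ ∷ []) (w₀ ∷ w₁ ∷ w₂ ∷ []) =
    cong₂ _∷_ (cross-cross₀ x₀ x₁ x₂ z₀ z₁ z₂ w₀ w₁ w₂)
    (cong₂ _∷_ (trans (cross-cross₀ x₁ x₂ x₀ z₁ z₂ z₀ w₁ w₂ w₀)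
                 (cong₂ (λ s t → s ⊗ z₁ ⊝ t ⊗ x₁) (dot-rotate x₀ x₁ x₂ w₀ w₁ w₂) (dot-rotate z₀ z₁ z₂ w₀ w₁ w₂)))
    (cong (_∷ []) (trans (cross-cross₀ x₂ x₀ x₁ z₂ z₀ z₁ w₂ w₀ w₁)
                 (cong₂ (λ s t → s ⊗ z₂ ⊝ t ⊗ x₂) (sym (dot-rotate x₂ x₀ x₁ w₂ w₀ w₁)) (sym (dot-rotate z₂ z₀ z₁ w₂ w₀ w₁))))))

  dot-crossˡ : ∀ x z → dot x (cross x z) ≡ 𝟘
  dot-crossˡ (x₀ ∷ x₁ ∷ x₂ ∷ []) (z₀ ∷ z₁ ∷ z₂ ∷ []) = solve 6 (λ x₀ x₁ x₂ z₀ z₁ z₂ →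
      x₀ :* (x₁ :* z₂ :- x₂ :* z₁) :+ (x₁ :* (x₂ :* z₀ :- x₀ :* z₂) :+ x₂ :* (x₀ :* z₁ :- x₁ :* z₀)) := con (ℤ.+ 0))
      refl x₀ x₁ x₂ z₀ z₁ z₂
    where open Solver

  cross-zeroˡ : ∀ y → cross 𝟎 y ≡ 𝟎
  cross-zeroˡ (y₀ ∷ y₁ ∷ y₂ ∷ []) = cong₂ _∷_ (z y₂ y₁) (cong₂ _∷_ (z y₀ y₂) (cong (_∷ []) (z y₁ y₀)))
    where
    z : ∀ a b → 𝟘 ⊗ a ⊝ 𝟘 ⊗ b ≡ 𝟘
    z a b = trans (cong₂ _⊝_ (𝔽.zeroˡ a) (𝔽.zeroˡ b)) (𝔽.-‿inverseʳ 𝟘)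

  det-3 : ∀ x y z → det 𝔽 (λ i → lookup (lookup (x ∷ y ∷ z ∷ []) i)) ≡ dot x (cross y z)
  det-3 (x₀ ∷ x₁ ∷ x₂ ∷ []) (y₀ ∷ y₁ ∷ y₂ ∷ []) (z₀ ∷ z₁ ∷ z₂ ∷ []) =
    solve 9 (λ x₀ x₁ x₂ y₀ y₁ y₂ z₀ z₁ z₂ →
      -- The polynomial repeats the unfolding of `det` literally, with its signs, its empty
      -- determinants 1 and its empty sums 0.
      let 1' = con (ℤ.+ 1) ; 0' = con (ℤ.+ 0)
          d1 = λ a → (1' :* a) :* 1' :+ 0'
          d2 = λ a b c d → (1' :* a) :* d1 d :+ ((:- 1' :* b) :* d1 c :+ 0')
      in (1' :* x₀) :* d2 y₁ y₂ z₁ z₂ :+ ((:- 1' :* x₁) :* d2 y₀ y₂ z₀ z₂ :+ ((:- :- 1' :* x₂) :* d2 y₀ y₁ z₀ z₁ :+ 0'))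
      := x₀ :* (y₁ :* z₂ :- y₂ :* z₁) :+ (x₁ :* (y₂ :* z₀ :- y₀ :* z₂) :+ x₂ :* (y₀ :* z₁ :- y₁ :* z₀)))
      refl x₀ x₁ x₂ y₀ y₁ y₂ z₀ z₁ z₂
    where open Solver

  -- `Vec` is preferred to functions so that propositional equality of vectors is decidable and the
  -- list can be complete for it.
  vectors : ∀ n → Finite (Vec A n)
  vectors zero = record
    { elements = List.[ [] ] ; unique = [] ∷ [] ; complete = λ { [] → here refl } }
  vectors (suc n) = record
    { elements = cartesianProductWith _∷_ (allFin q) (Finite.elements (vectors n))
    ; unique   = Unique.cartesianProductWith⁺ _∷_ ∷-injective (Unique.allFin⁺ q) (Finite.unique (vectors n))
    ; complete = λ { (x ∷ v) → ∈-cartesianProductWith⁺ _∷_ (∈-allFin x) (Finite.complete (vectors n) v) }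
    }

  size-vectors : ∀ n → Finite.size (vectors n) ≡ q ^ n
  size-vectors zero    = refl
  size-vectors (suc n) = trans (length-cartesianProductWith _∷_ (allFin q) (Finite.elements (vectors n)))
                               (cong₂ _*_ {x = length (allFin q)} {y = q} (length-tabulate id) (size-vectors n))

  #-all-vectors : # (vectors n) (λ _ → yes tt) ≡ q ^ n
  #-all-vectors {n} = trans (∑-const (elements (vectors n)) 1) (trans (*-identityʳ _) (size-vectors n))

  𝕍 : Finite (Vec A 3)
  𝕍 = vectors 3

  V = elements 𝕍

  nonzero-coordinate : ∀ {x₀ x₁ x₂} → x₀ ∷ x₁ ∷ x₂ ∷ [] ≢ 𝟎 → x₀ ≢ 𝟘 ⊎ x₁ ≢ 𝟘 ⊎ x₂ ≢ 𝟘
  nonzero-coordinate {x₀} {x₁} {x₂} x≢𝟎 with x₀ ≟ 𝟘 | x₁ ≟ 𝟘 | x₂ ≟ 𝟘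
  ... | no x₀≢0  | _        | _        = inj₁ x₀≢0
  ... | yes _    | no x₁≢0  | _        = inj₂ (inj₁ x₁≢0)
  ... | yes _    | yes _    | no x₂≢0  = inj₂ (inj₂ x₂≢0)
  ... | yes refl | yes refl | yes refl = contradiction refl x≢𝟎

  -- If the i-th coordinate of x is nonzero, the two coordinates of x × z that involve it determine
  -- the rest of z from the i-th coordinate of z. The fibre therefore embeds into the field.
  cross-fibre : ∀ {x} → x ≢ 𝟎 → ∀ u → # 𝕍 (λ z → cross x z ≟ᵛ u) ≤ q
  cross-fibre {x} x≢𝟎 u = let i , injective = separating x≢𝟎 in ≤-trans
    (#-injective 𝕍 (vectors 1) _≟ᵛ_ (λ z → cross x z ≟ᵛ u) (λ _ → yes tt) (λ z → lookup z i ∷ []) _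
      (λ xz≡u xz′≡u eq → injective (trans xz≡u (sym xz′≡u)) (proj₁ (∷-injective eq))))
    (≤-reflexive (trans #-all-vectors (*-identityʳ q)))
    where
    separating : ∀ {x} → x ≢ 𝟎 →
      ∃ λ i → ∀ {z z′} → cross x z ≡ cross x z′ → lookup z i ≡ lookup z′ i → z ≡ z′
    separating {x₀ ∷ x₁ ∷ x₂ ∷ []} x≢𝟎 with nonzero-coordinate x≢𝟎
    ... | inj₁ x₀≢0 = zero , λ { {_ ∷ _ ∷ _ ∷ []} {_ ∷ _ ∷ _ ∷ []} eq refl →
      let _ , eq₁₂ = ∷-injective eq ; eq₁ , eq₂₃ = ∷-injective eq₁₂ ; eq₂ , _ = ∷-injective eq₂₃
      in cong₂ (λ s t → _ ∷ s ∷ t ∷ []) (⊗-cancelˡ x₀≢0 (⊝-cancelʳ _ eq₂)) (⊗-cancelˡ x₀≢0 (⊝-cancelˡ _ eq₁)) }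
    ... | inj₂ (inj₁ x₁≢0) = suc zero , λ { {_ ∷ _ ∷ _ ∷ []} {_ ∷ _ ∷ _ ∷ []} eq refl →
      let eq₀ , eq₁₂ = ∷-injective eq ; eq₁ , eq₂₃ = ∷-injective eq₁₂ ; eq₂ , _ = ∷-injective eq₂₃
      in cong₂ (λ s t → s ∷ _ ∷ t ∷ []) (⊗-cancelˡ x₁≢0 (⊝-cancelˡ _ eq₂)) (⊗-cancelˡ x₁≢0 (⊝-cancelʳ _ eq₀)) }
    ... | inj₂ (inj₂ x₂≢0) = suc (suc zero) , λ { {_ ∷ _ ∷ _ ∷ []} {_ ∷ _ ∷ _ ∷ []} eq refl →
      let eq₀ , eq₁₂ = ∷-injective eq ; eq₁ , _ = ∷-injective eq₁₂
      in cong₂ (λ s t → s ∷ t ∷ _ ∷ []) (⊗-cancelˡ x₂≢0 (⊝-cancelʳ _ eq₁)) (⊗-cancelˡ x₂≢0 (⊝-cancelˡ _ eq₀)) }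

  -- On both planes (x × z) × w has the constant value s z - t x, so w lies in one fibre of the
  -- cross product with the nonzero vector x × z.
  plane-intersection : ∀ {x z} → cross x z ≢ 𝟎 → ∀ s t →
    # 𝕍 (λ w → (dot x w ≟ s) ×-dec (dot z w ≟ t)) ≤ q
  plane-intersection {x} {z} xz≢𝟎 s t = ≤-trans
    (#-mono 𝕍 (λ w → (dot x w ≟ s) ×-dec (dot z w ≟ t)) (λ w → cross (cross x z) w ≟ᵛ (scale s z -ᵛ scale t x))
      λ {w} (xw≡s , zw≡t) → trans (cross-cross x z w) (cong₂ (λ s t → scale s z -ᵛ scale t x) xw≡s zw≡t))
    (cross-fibre xz≢𝟎 (scale s z -ᵛ scale t x))

  -- Distinct z, z′ on a line through 0 take the nonzero value a at no common w.
  parallel-planes : ∀ {z z′} → z ≢ z′ → ∀ {a} → a ≢ 𝟘 →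
    # 𝕍 (λ w → (dot z w ≟ a) ×-dec (dot z′ w ≟ a)) ≤ q
  parallel-planes {z} {z′} z≢z′ {a} a≢0 with cross z z′ ≟ᵛ 𝟎
  ... | no zz′≢𝟎  = plane-intersection zz′≢𝟎 a a
  ... | yes zz′≡𝟎 = ≤-trans (≤-reflexive (#-none 𝕍 (λ w → (dot z w ≟ a) ×-dec (dot z′ w ≟ a))
    λ w (zw≡a , z′w≡a) → z≢z′ (sym (scale-cancel-ᵛ a≢0 (scale a z) (begin
      scale a z′ -ᵛ scale a z                  ≡⟨ cong₂ (λ s t → scale s z′ -ᵛ scale t z) zw≡a z′w≡a ⟨
      scale (dot z w) z′ -ᵛ scale (dot z′ w) z ≡⟨ cross-cross z z′ w ⟨
      cross (cross z z′) w                     ≡⟨ cong (λ u → cross u w) zz′≡𝟎 ⟩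
      cross 𝟎 w                                ≡⟨ cross-zeroˡ w ⟩
      𝟎                                        ≡⟨ v-v≡𝟎 (scale a z) ⟨
      scale a z -ᵛ scale a z                   ∎))))) z≤n
    where open ≡-Reasoning

  -- At a nonzero coordinate of z, the matching coordinate of w can be solved for while the other
  -- two stay free.
  plane-≥ : ∀ {z} → z ≢ 𝟎 → ∀ a → q ^ 2 ≤ # 𝕍 (λ w → dot z w ≟ a)
  plane-≥ {z} z≢𝟎 a = let point , on , injective = parametrise z z≢𝟎 in ≤-trans (≤-reflexive (sym #-all-vectors))
    (#-injective (vectors 2) 𝕍 _≟ᵛ_ (λ _ → yes tt) (λ w → dot z w ≟ a) point (λ {u} _ → on u) (λ _ _ → injective))
    where
    solution : ∀ {x} → x ≢ 𝟘 → A → A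
    solution x≢0 c = proj₁ (inverse _ x≢0) ⊗ (a ⊝ c)
    solution-correct : ∀ {x} (x≢0 : x ≢ 𝟘) c → x ⊗ solution x≢0 c ⊕ c ≡ a
    solution-correct {x} x≢0 c with y , xy≡1 ← inverse x x≢0 = begin
      x ⊗ (y ⊗ (a ⊝ c)) ⊕ c   ≡⟨ cong (_⊕ c) (𝔽.*-assoc x y _) ⟨
      x ⊗ y ⊗ (a ⊝ c) ⊕ c     ≡⟨ cong (λ e → e ⊗ (a ⊝ c) ⊕ c) xy≡1 ⟩
      𝟙 ⊗ (a ⊝ c) ⊕ c         ≡⟨ solve 2 (λ a c → con (ℤ.+ 1) :* (a :- c) :+ c := a) refl a c ⟩
      a                       ∎
      where
      open ≡-Reasoning
      open Solver
    parametrise : ∀ z → z ≢ 𝟎 → ∃ λ (point : Vec A 2 → Vec A 3) →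
      (∀ u → dot z (point u) ≡ a) × (∀ {u u′} → point u ≡ point u′ → u ≡ u′)
    parametrise (z₀ ∷ z₁ ∷ z₂ ∷ []) z≢𝟎 with nonzero-coordinate z≢𝟎
    ... | inj₁ z₀≢0 =
      (λ { (s ∷ t ∷ []) → solution z₀≢0 (z₁ ⊗ s ⊕ z₂ ⊗ t) ∷ s ∷ t ∷ [] }) ,
      (λ { (s ∷ t ∷ []) → solution-correct z₀≢0 _ }) ,
      (λ { {_ ∷ _ ∷ []} {_ ∷ _ ∷ []} refl → refl })
    ... | inj₂ (inj₁ z₁≢0) =
      (λ { (s ∷ t ∷ []) → s ∷ solution z₁≢0 (z₀ ⊗ s ⊕ z₂ ⊗ t) ∷ t ∷ [] }) ,
      (λ { (s ∷ t ∷ []) → trans (x∙yz≈y∙xz _ _ _) (solution-correct z₁≢0 _) }) ,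
      (λ { {_ ∷ _ ∷ []} {_ ∷ _ ∷ []} refl → refl })
    ... | inj₂ (inj₂ z₂≢0) =
      (λ { (s ∷ t ∷ []) → s ∷ t ∷ solution z₂≢0 (z₀ ⊗ s ⊕ z₁ ⊗ t) ∷ [] }) ,
      (λ { (s ∷ t ∷ []) → trans (x∙yz≈z∙xy _ _ _) (solution-correct z₂≢0 _) }) ,
      (λ { {_ ∷ _ ∷ []} {_ ∷ _ ∷ []} refl → refl })

  2≤q : 2 ≤ q
  2≤q = ≰⇒> λ q≤1 → 1≢0 (collapse q≤1 𝟙 𝟘)
    where
    collapse : ∀ {m} → m ≤ 1 → (x y : Fin m) → x ≡ y
    collapse (s≤s z≤n) zero zero = refl

  -- Second moment bound on the number of cross products

  module _ {E : Vec A 3 → Set} (E? : Decidable E) (E-nonzero : ∀ {x} → E x → x ≢ 𝟎) where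

    N = # 𝕍 E?

    CrossProduct : Vec A 3 → Set
    CrossProduct w = ∃₂ λ x y → (E x × E y) × cross x y ≡ w

    CrossProduct? : Decidable CrossProduct
    CrossProduct? w = ∃? 𝕍 λ x → ∃? 𝕍 λ y → (E? x ×-dec E? y) ×-dec (cross x y ≟ᵛ w)

    B = # 𝕍 CrossProduct?

    module _ {a} (a≢0 : a ≢ 𝟘) (missed : ∀ {x y z} → E x → E y → E z → dot z (cross x y) ≢ a)
      (N-large : 2 * q ^ 2 ≤ suc N) where

      hits : Vec A 3 → ℕ
      hits w = # 𝕍 (λ z → E? z ×-dec (dot z w ≟ a))

      private
        S = ∑ V hits
        T = ∑[ w ∈ V ] (hits w * hits w)

        through : Vec A 3 → ℕ
        through z = # 𝕍 (λ w → dot z w ≟ a)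

        S≡ : S ≡ ∑[ z ∈ V ] ([ E? z ] * through z)
        S≡ = trans (∑-swap V V _) (∑-cong V λ z → #-×ˡ 𝕍 (E? z) (λ w → dot z w ≟ a))

        S≥ : q ^ 2 * N ≤ S
        S≥ = begin
          q ^ 2 * N                             ≡⟨ *-comm (q ^ 2) N ⟩
          N * q ^ 2                             ≡⟨ ∑-*ʳ V (q ^ 2) _ ⟨
          ∑[ z ∈ V ] ([ E? z ] * q ^ 2)
            ≤⟨ ∑-mono V (λ z → []*-mono (E? z) λ Ez → plane-≥ (E-nonzero Ez) a) ⟩
          ∑[ z ∈ V ] ([ E? z ] * through z)     ≡⟨ S≡ ⟨
          S                                     ∎
          where open ≤-Reasoning

        common : Vec A 3 → Vec A 3 → ℕ
        common z z′ = # 𝕍 (λ w → (dot z w ≟ a) ×-dec (dot z′ w ≟ a))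

        -- The diagonal counts a whole plane. Summed over E it contributes `S` to the bound on `T`,
        -- against q for each of the N² pairs.
        common-≤ : ∀ z z′ → common z z′ ≤ q + [ z ≟ᵛ z′ ] * through z
        common-≤ z z′ with z ≟ᵛ z′
        ... | no z≢z′ = ≤-trans (parallel-planes z≢z′ a≢0) (m≤m+n q 0)
        ... | yes refl = ≤-trans (#-mono 𝕍 (λ w → (dot z w ≟ a) ×-dec (dot z w ≟ a)) (λ w → dot z w ≟ a) proj₁)
                           (≤-trans (≤-reflexive (sym (+-identityʳ _))) (m≤n+m _ q))

        T≡ : T ≡ ∑[ z ∈ V ] ([ E? z ] * ∑[ z′ ∈ V ] ([ E? z′ ] * common z z′))
        T≡ = begin
          ∑[ w ∈ V ] (hits w * hits w)
            ≡⟨ ∑-cong V (λ w → ∑-product V V _ _) ⟩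
          ∑[ w ∈ V ] ∑[ z ∈ V ] ∑[ z′ ∈ V ] ([ E? z ×-dec (dot z w ≟ a) ] * [ E? z′ ×-dec (dot z′ w ≟ a) ])
            ≡⟨ ∑-swap V V _ ⟩
          ∑[ z ∈ V ] ∑[ w ∈ V ] ∑[ z′ ∈ V ] ([ E? z ×-dec (dot z w ≟ a) ] * [ E? z′ ×-dec (dot z′ w ≟ a) ])
            ≡⟨ ∑-cong V (λ z → trans (∑-swap V V _) (trans (∑-cong V λ z′ → pair z z′) (∑-*ˡ V [ E? z ] _))) ⟩
          ∑[ z ∈ V ] ([ E? z ] * ∑[ z′ ∈ V ] ([ E? z′ ] * common z z′)) ∎
          where
          open ≡-Reasoning
          pair : ∀ z z′ → ∑[ w ∈ V ] ([ E? z ×-dec (dot z w ≟ a) ] * [ E? z′ ×-dec (dot z′ w ≟ a) ])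
                          ≡ [ E? z ] * ([ E? z′ ] * common z z′)
          pair z z′ = trans (∑-cong V λ w → trans
              (cong₂ _*_ ([]-× (E? z) (dot z w ≟ a)) ([]-× (E? z′) (dot z′ w ≟ a)))
              (trans (+-*-Solver.solve 4 (λ e d e′ d′ → let open +-*-Solver in (e :* d) :* (e′ :* d′) := (e :* e′) :* (d :* d′)) refl
                       [ E? z ] [ dot z w ≟ a ] [ E? z′ ] [ dot z′ w ≟ a ])
                     (cong ([ E? z ] * [ E? z′ ] *_) (sym ([]-× (dot z w ≟ a) (dot z′ w ≟ a))))))
            (trans (∑-*ˡ V ([ E? z ] * [ E? z′ ]) _) (*-assoc [ E? z ] _ _))

        T≤ : T ≤ q * (N * N) + S
        T≤ = begin
          T                                                        ≡⟨ T≡ ⟩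
          ∑[ z ∈ V ] ([ E? z ] * ∑[ z′ ∈ V ] ([ E? z′ ] * common z z′))
            ≤⟨ ∑-mono V (λ z → *-monoʳ-≤ [ E? z ] (inner z)) ⟩
          ∑[ z ∈ V ] ([ E? z ] * (N * q + through z))
            ≡⟨ ∑-cong V (λ z → *-distribˡ-+ [ E? z ] _ _) ⟩
          ∑[ z ∈ V ] ([ E? z ] * (N * q) + [ E? z ] * through z)
            ≡⟨ ∑-+ V _ _ ⟩
          ∑[ z ∈ V ] ([ E? z ] * (N * q)) + ∑[ z ∈ V ] ([ E? z ] * through z)
            ≡⟨ cong₂ _+_ (trans (∑-*ʳ V (N * q) _) (trans (sym (*-assoc N N q)) (*-comm (N * N) q))) (sym S≡) ⟩
          q * (N * N) + S                                          ∎
          where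
          open ≤-Reasoning
          inner : ∀ z → ∑[ z′ ∈ V ] ([ E? z′ ] * common z z′) ≤ N * q + through z
          inner z = begin
            ∑[ z′ ∈ V ] ([ E? z′ ] * common z z′)
              ≤⟨ ∑-mono V (λ z′ → *-monoʳ-≤ [ E? z′ ] (common-≤ z z′)) ⟩
            ∑[ z′ ∈ V ] ([ E? z′ ] * (q + [ z ≟ᵛ z′ ] * through z))
              ≡⟨ ∑-cong V (λ z′ → *-distribˡ-+ [ E? z′ ] q _) ⟩
            ∑[ z′ ∈ V ] ([ E? z′ ] * q + [ E? z′ ] * ([ z ≟ᵛ z′ ] * through z))
              ≡⟨ ∑-+ V _ _ ⟩
            ∑[ z′ ∈ V ] ([ E? z′ ] * q) + ∑[ z′ ∈ V ] ([ E? z′ ] * ([ z ≟ᵛ z′ ] * through z))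
              ≤⟨ +-mono-≤ (≤-reflexive (∑-*ʳ V q _)) (∑-mono V (λ z′ → []*≤ (E? z′) (λ _ → ≤-refl))) ⟩
            N * q + ∑[ z′ ∈ V ] ([ z ≟ᵛ z′ ] * through z)
              ≡⟨ cong (N * q +_) (∑-*ʳ V (through z) _) ⟩
            N * q + # 𝕍 (z ≟ᵛ_) * through z
              ≤⟨ +-monoʳ-≤ (N * q) (*-monoˡ-≤ (through z) (#-subsingleton 𝕍 (z ≟ᵛ_) λ z≡x z≡y → trans (sym z≡x) z≡y)) ⟩
            N * q + 1 * through z
              ≡⟨ cong (N * q +_) (*-identityˡ _) ⟩
            N * q + through z ∎

        missed-plane : ∀ {w} → CrossProduct w → hits w ≡ 0
        missed-plane {w} (x , y , (Ex , Ey) , refl) =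
          #-none 𝕍 (λ z → E? z ×-dec (dot z w ≟ a)) (λ z (Ez , eq) → missed Ex Ey Ez eq)

        -- AM-GM for hits w and its mean N / q; the term N² is to spare where hits w = 0.
        pointwise : ∀ w → 2 * (N * (q * hits w)) + N * N * [ CrossProduct? w ] ≤ N * N + q * q * (hits w * hits w)
        pointwise w = case (CrossProduct? w) missed-plane
          where
          open import Algebra.Properties.CommutativeSemigroup *-commutativeSemigroup using (interchange)
          case : ∀ {P : Set} (d : Dec P) {h} → (P → h ≡ 0) →
                 2 * (N * (q * h)) + N * N * [ d ] ≤ N * N + q * q * (h * h)
          case (yes p) {h} h≡0 rewrite h≡0 p | *-zeroʳ q | *-zeroʳ N | *-zeroʳ (q * q) =
            ≤-reflexive (trans (*-identityʳ (N * N)) (sym (+-identityʳ (N * N))))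
          case (no _)  {h} _ rewrite *-zeroʳ (N * N) = ≤-trans (≤-reflexive (+-identityʳ _))
            (≤-trans (2mn≤m²+n² N (q * h)) (≤-reflexive (cong (N * N +_) (interchange q h q h))))

      -- Chebyshev's inequality: each cross product contributes N² to the sum of (q hits - N)² over
      -- all q³ vectors, and that sum is at most q⁴ N. `pointwise` and the arithmetic lemma express
      -- this without subtraction.
      few-cross-products : N * B ≤ q ^ 4
      few-cross-products = missed-planes-arithmetic q N B S T 1≤N q≤2N S≥ T≤ (begin
        2 * (N * (q * S)) + N * N * B
          ≡⟨ cong₂ _+_ (trans (cong (λ t → 2 * (N * t)) (sym (∑-*ˡ V q hits)))
               (trans (cong (2 *_) (sym (∑-*ˡ V N _))) (sym (∑-*ˡ V 2 _)))) (sym (∑-*ˡ V (N * N) _)) ⟩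
        ∑[ w ∈ V ] (2 * (N * (q * hits w))) + ∑[ w ∈ V ] (N * N * [ CrossProduct? w ])
          ≡⟨ ∑-+ V _ _ ⟨
        ∑[ w ∈ V ] (2 * (N * (q * hits w)) + N * N * [ CrossProduct? w ])
          ≤⟨ ∑-mono V pointwise ⟩
        ∑[ w ∈ V ] (N * N + q * q * (hits w * hits w))
          ≡⟨ ∑-+ V _ _ ⟩
        ∑[ w ∈ V ] (N * N) + ∑[ w ∈ V ] (q * q * (hits w * hits w))
          ≡⟨ cong₂ _+_ (trans (∑-const V (N * N)) (cong (_* (N * N)) (size-vectors 3))) (∑-*ˡ V (q * q) _) ⟩
        q ^ 3 * (N * N) + q * q * T ∎)
        where
        open ≤-Reasoning
        q≤N : q ≤ N
        q≤N = ≤-pred (begin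
          1 + q       ≤⟨ +-monoˡ-≤ q (≤-trans (s≤s z≤n) 2≤q) ⟩
          q + q       ≡⟨ cong (q +_) (+-identityʳ q) ⟨
          2 * q       ≤⟨ *-monoʳ-≤ 2 (m≤m^n q 2≤q) ⟩
          2 * q ^ 2   ≤⟨ N-large ⟩
          suc N       ∎)
          where
          m≤m^n : ∀ q → 2 ≤ q → q ≤ q ^ 2
          m≤m^n q@(suc _) _ = ≤-trans (m≤m*n q q) (≤-reflexive (cong (q *_) (sym (*-identityʳ q))))
        1≤N : 1 ≤ N
        1≤N = ≤-trans (s≤s z≤n) (≤-trans 2≤q q≤N)
        q≤2N : q ≤ 2 * N
        q≤2N = ≤-trans q≤N (m≤m+n N (N + 0))

    -- Incidences between the set and its cross products

    degree : Vec A 3 → ℕ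
    degree x = # 𝕍 (λ w → CrossProduct? w ×-dec (dot x w ≟ 𝟘))

    planeSize : Vec A 3 → ℕ
    planeSize w = # 𝕍 (λ z → E? z ×-dec (dot z w ≟ 𝟘))

    -- The lines joining x to the points of E all pass through x, and each vector arises as x × z
    -- for at most q vectors z.
    N≤q*degree : ∀ {x} → E x → N ≤ q * degree x
    N≤q*degree {x} Ex = #≤fibre*# 𝕍 𝕍 _≟ᵛ_ E? (λ w → CrossProduct? w ×-dec (dot x w ≟ 𝟘)) (cross x) q
      (λ {z} Ez → (x , z , (Ex , Ez) , refl) , dot-crossˡ x z)
      (λ u → ≤-trans (#-mono 𝕍 (λ z → E? z ×-dec (cross x z ≟ᵛ u)) (λ z → cross x z ≟ᵛ u) proj₂)
                     (cross-fibre (E-nonzero Ex) u))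

    -- Distinct points of the line w are joined to x by distinct lines: for z · w = 0 the triple
    -- product (x × z) × w is (x · w) z, from which the nonzero x · w cancels.
    planeSize≤degree : ∀ {x} → E x → ∀ {w} → dot x w ≢ 𝟘 → planeSize w ≤ degree x
    planeSize≤degree {x} Ex {w} xw≢0 = #-injective 𝕍 𝕍 _≟ᵛ_
      (λ z → E? z ×-dec (dot z w ≟ 𝟘)) (λ w → CrossProduct? w ×-dec (dot x w ≟ 𝟘)) (cross x)
      (λ {z} (Ez , _) → (x , z , (Ex , Ez) , refl) , dot-crossˡ x z)
      (λ (_ , zw≡0) (_ , z′w≡0) eq → scale-cancel-ᵛ xw≢0 (scale 𝟘 x)
        (trans (sym (expand zw≡0)) (trans (cong (λ u → cross u w) eq) (expand z′w≡0))))
      where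
      expand : ∀ {z} → dot z w ≡ 𝟘 → cross (cross x z) w ≡ scale (dot x w) z -ᵛ scale 𝟘 x
      expand {z} zw≡0 = trans (cross-cross x z w) (cong (λ t → scale (dot x w) z -ᵛ scale t x) zw≡0)

    module _ {x} (Ex : E x) (minimal : ∀ {y} → E y → degree x ≤ degree y) where

      private
        r = degree x
        incident : ∀ w → Dec (CrossProduct w × dot x w ≡ 𝟘)
        incident w = CrossProduct? w ×-dec (dot x w ≟ 𝟘)

      -- Count incidences by points, where minimality gives at least r for each, and then by lines.
      flags : N * r ≤ ∑[ w ∈ V ] ([ CrossProduct? w ] * planeSize w)
      flags = begin
        N * r                                    ≡⟨ ∑-*ʳ V r _ ⟨
        ∑[ y ∈ V ] ([ E? y ] * r)                ≤⟨ ∑-mono V (λ y → []*-mono (E? y) minimal) ⟩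
        ∑[ y ∈ V ] ([ E? y ] * degree y)
          ≡⟨ ∑-cong V (λ y → sym (#-×ˡ 𝕍 (E? y) (λ w → CrossProduct? w ×-dec (dot y w ≟ 𝟘)))) ⟩
        ∑[ y ∈ V ] # 𝕍 (λ w → E? y ×-dec (CrossProduct? w ×-dec (dot y w ≟ 𝟘)))
          ≡⟨ ∑-swap V V _ ⟩
        ∑[ w ∈ V ] # 𝕍 (λ y → E? y ×-dec (CrossProduct? w ×-dec (dot y w ≟ 𝟘)))
          ≡⟨ ∑-cong V (λ w → trans (∑-cong V λ y → exchange (E? y) (CrossProduct? w) (dot y w ≟ 𝟘))
                                   (#-×ˡ 𝕍 (CrossProduct? w) (λ y → E? y ×-dec (dot y w ≟ 𝟘)))) ⟩
        ∑[ w ∈ V ] ([ CrossProduct? w ] * planeSize w)     ∎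
        where
        open ≤-Reasoning
        exchange : ∀ {P Q R : Set} (d : Dec P) (e : Dec Q) (f : Dec R) →
                   [ d ×-dec (e ×-dec f) ] ≡ [ e ×-dec (d ×-dec f) ]
        exchange (yes _) (yes _) f = refl
        exchange (yes _) (no _)  f = refl
        exchange (no _)  (yes _) f = refl
        exchange (no _)  (no _)  f = refl

      -- A line missing x has at most r points, while lines through x keep their size on the right.
      -- The r added on the left for each line through x avoids the subtraction in r (B - r); these
      -- terms sum to r².
      split-flags : ∀ w → [ CrossProduct? w ] * planeSize w + r * [ incident w ] ≤
                          r * [ CrossProduct? w ] + [ incident w ] * planeSize w
      split-flags w = case (CrossProduct? w) (dot x w ≟ 𝟘) (planeSize≤degree Ex)
        where
        case : ∀ {P Q : Set} (d : Dec P) (e : Dec Q) {k} → (¬ Q → k ≤ r) →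
               [ d ] * k + r * [ d ×-dec e ] ≤ r * [ d ] + [ d ×-dec e ] * k
        case (no _)  e       _ = ≤-trans (≤-reflexive (*-zeroʳ r)) z≤n
        case (yes _) (yes _) {k} _ = ≤-reflexive (+-comm (1 * k) (r * 1))
        case (yes _) (no ¬q) {k} h = begin
          1 * k + r * 0   ≡⟨ cong₂ _+_ (*-identityˡ k) (*-zeroʳ r) ⟩
          k + 0           ≤⟨ +-monoˡ-≤ 0 (h ¬q) ⟩
          r + 0           ≡⟨ cong (_+ 0) (*-identityʳ r) ⟨
          r * 1 + 0       ∎
          where open ≤-Reasoning

      -- Sum over z first. If x × z ≠ 0, a common line lies in two planes that meet in at most q
      -- vectors; at most q vectors z have x × z = 0, and each of these is on at most all r lines
      -- through x.
      incident-flags : ∑[ w ∈ V ] ([ incident w ] * planeSize w) ≤ q * N + r * q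
      incident-flags = begin
        ∑[ w ∈ V ] ([ incident w ] * planeSize w)
          ≡⟨ ∑-cong V (λ w → sym (#-×ˡ 𝕍 (incident w) (λ z → E? z ×-dec (dot z w ≟ 𝟘)))) ⟩
        ∑[ w ∈ V ] # 𝕍 (λ z → incident w ×-dec (E? z ×-dec (dot z w ≟ 𝟘)))
          ≡⟨ ∑-swap V V _ ⟩
        ∑[ z ∈ V ] # 𝕍 (λ w → incident w ×-dec (E? z ×-dec (dot z w ≟ 𝟘)))
          ≤⟨ ∑-mono V bound ⟩
        ∑[ z ∈ V ] (q * [ E? z ] + r * [ cross x z ≟ᵛ 𝟎 ])
          ≡⟨ ∑-+ V _ _ ⟩
        ∑[ z ∈ V ] (q * [ E? z ]) + ∑[ z ∈ V ] (r * [ cross x z ≟ᵛ 𝟎 ])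
          ≡⟨ cong₂ _+_ (∑-*ˡ V q _) (∑-*ˡ V r _) ⟩
        q * N + r * # 𝕍 (λ z → cross x z ≟ᵛ 𝟎)
          ≤⟨ +-monoʳ-≤ (q * N) (*-monoʳ-≤ r (cross-fibre (E-nonzero Ex) 𝟎)) ⟩
        q * N + r * q ∎
        where
        open ≤-Reasoning
        both : Vec A 3 → Vec A 3 → ℕ
        both z w = [ incident w ×-dec (E? z ×-dec (dot z w ≟ 𝟘)) ]
        bound : ∀ z → ∑ V (both z) ≤ q * [ E? z ] + r * [ cross x z ≟ᵛ 𝟎 ]
        bound z = case (E? z) (cross x z ≟ᵛ 𝟎)
          (λ ¬Ez → ∑-zero V λ w → [ incident w ×-dec (E? z ×-dec (dot z w ≟ 𝟘)) ]≡0 (¬Ez ∘ proj₁ ∘ proj₂))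
          (∑-mono V λ w → []-mono (incident w ×-dec (E? z ×-dec (dot z w ≟ 𝟘))) (incident w) proj₁)
          (λ xz≢𝟎 → ≤-trans
            (#-mono 𝕍 (λ w → incident w ×-dec (E? z ×-dec (dot z w ≟ 𝟘))) (λ w → (dot x w ≟ 𝟘) ×-dec (dot z w ≟ 𝟘))
               (λ ((_ , xw≡0) , (_ , zw≡0)) → xw≡0 , zw≡0))
            (plane-intersection xz≢𝟎 𝟘 𝟘))
          where
          case : ∀ {P Q : Set} (d : Dec P) (e : Dec Q) {k} → (¬ P → k ≡ 0) → k ≤ r → (¬ Q → k ≤ q) →
                 k ≤ q * [ d ] + r * [ e ]
          case (no ¬p) e       h₀ _ _ = ≤-trans (≤-reflexive (h₀ ¬p)) z≤n
          case (yes _) (yes _) _ h₁ _ = ≤-trans h₁ (≤-trans (≤-reflexive (sym (*-identityʳ r))) (m≤n+m _ (q * 1)))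
          case (yes _) (no ¬q) _ _ h₂ = ≤-trans (h₂ ¬q) (≤-trans (≤-reflexive (sym (*-identityʳ q))) (m≤m+n _ (r * 0)))

      many-cross-products : N * r + r * r ≤ r * B + (q * N + r * q)
      many-cross-products = begin
        N * r + r * r
          ≤⟨ +-monoˡ-≤ (r * r) flags ⟩
        ∑[ w ∈ V ] ([ CrossProduct? w ] * planeSize w) + r * r
          ≡⟨ cong (_ +_) (∑-*ˡ V r (λ w → [ incident w ])) ⟨
        ∑[ w ∈ V ] ([ CrossProduct? w ] * planeSize w) + ∑[ w ∈ V ] (r * [ incident w ])
          ≡⟨ ∑-+ V _ _ ⟨
        ∑[ w ∈ V ] ([ CrossProduct? w ] * planeSize w + r * [ incident w ])
          ≤⟨ ∑-mono V split-flags ⟩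
        ∑[ w ∈ V ] (r * [ CrossProduct? w ] + [ incident w ] * planeSize w)
          ≡⟨ ∑-+ V _ _ ⟩
        ∑[ w ∈ V ] (r * [ CrossProduct? w ]) + ∑[ w ∈ V ] ([ incident w ] * planeSize w)
          ≤⟨ +-mono-≤ (≤-reflexive (∑-*ˡ V r _)) incident-flags ⟩
        r * B + (q * N + r * q) ∎
        where open ≤-Reasoning

  -- Volumes in dimension three

  nonzero-element : ∀ {E : Vec A n → Set} (E? : Decidable E) → 2 ≤ # (vectors n) E? → ∃ λ x → E x × x ≢ 𝟎
  nonzero-element {n} {E} E? 2≤# with ∃? (vectors n) (λ x → E? x ×-dec ¬? (x ≟ᵛ 𝟎))
  ... | yes found = found
  ... | no none   = contradiction
    (≤-trans 2≤# (#-subsingleton (vectors n) E? λ Ex Ey → trans (E-zero Ex) (sym (E-zero Ey)))) λ { (s≤s ()) }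
    where
    E-zero : ∀ {x} → E x → x ≡ 𝟎
    E-zero {x} Ex with x ≟ᵛ 𝟎
    ... | yes x≡𝟎 = x≡𝟎
    ... | no x≢𝟎  = contradiction (x , Ex , x≢𝟎) none

  -- Indexed by the dimension minus one.
  AllVolumes : ℕ → Set₁
  AllVolumes n = ∀ {E : Vec A (suc n) → Set} (E? : Decidable E) → 2 * q ^ n ≤ # (vectors (suc n)) E? →
    ∀ a → ∃ λ (x : Fin (suc n) → Vec A (suc n)) → (∀ i → E (x i)) × det 𝔽 (λ i → lookup (x i)) ≡ a

  2≤2q^n : ∀ n → 2 ≤ 2 * q ^ n
  2≤2q^n n = *-monoʳ-≤ 2 (m^n>0 q {{>-nonZero (≤-trans (s≤s z≤n) 2≤q)}} n)

  -- Failure of an exhaustive search is exactly the assumption `missed` of the second moment bound,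
  -- so the clash of the two bounds yields actual vectors.
  nonzero-volume : ∀ {E : Vec A 3 → Set} (E? : Decidable E) → (∀ {x} → E x → x ≢ 𝟎) → 2 * q ^ 2 ≤ suc (# 𝕍 E?) →
    ∀ {x} → E x → ∀ {a} → a ≢ 𝟘 → ∃ λ x → ∃ λ y → ∃ λ z → (E x × (E y × E z)) × dot z (cross x y) ≡ a
  nonzero-volume E? E-nonzero E-large Ex {a} a≢0
    with ∃? 𝕍 (λ x → ∃? 𝕍 λ y → ∃? 𝕍 λ z → (E? x ×-dec (E? y ×-dec E? z)) ×-dec (dot z (cross x y) ≟ a))
  ... | yes found = found
  ... | no none with y , Ey , minimal ← minimiser 𝕍 E? (degree E? E-nonzero) Ex = contradiction
    (few-cross-products E? E-nonzero a≢0 (λ Ex Ey Ez eq → none (_ , _ , _ , (Ex , Ey , Ez) , eq)) E-large)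
    (bounds-incompatible q (# 𝕍 E?) _ (degree E? E-nonzero y) 2≤q E-large (N≤q*degree E? E-nonzero Ey)
      (many-cross-products E? E-nonzero Ey minimal))

  allVolumes₃ : AllVolumes 2
  allVolumes₃ {E} E? E-large a
    with x , Ex , x≢𝟎 ← nonzero-element E? (≤-trans (2≤2q^n 2) E-large)
    with a ≟ 𝟘
  -- Volume zero comes from a repeated row, which leaves only nonzero a to the counting.
  ... | yes refl = (λ i → lookup (x ∷ x ∷ x ∷ []) i) ,
    (λ { zero → Ex ; (suc zero) → Ex ; (suc (suc zero)) → Ex }) , trans (det-3 x x x) (dot-crossˡ x x)
  ... | no a≢0 =
    let x , y , z , ((Ex , _) , (Ey , _) , (Ez , _)) , eq = nonzero-volume E*? proj₂ E*-large (Ex , x≢𝟎) a≢0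
    in (λ i → lookup (z ∷ x ∷ y ∷ []) i) ,
       (λ { zero → Ez ; (suc zero) → Ex ; (suc (suc zero)) → Ey }) , trans (det-3 z x y) eq
    where
    E*? : Decidable (λ x → E x × x ≢ 𝟎)
    E*? x = E? x ×-dec ¬? (x ≟ᵛ 𝟎)
    -- At most the zero vector is lost, whence the `suc`.
    E*-large : 2 * q ^ 2 ≤ suc (# 𝕍 E*?)
    E*-large = begin
      2 * q ^ 2                                     ≤⟨ E-large ⟩
      # 𝕍 E?                                        ≤⟨ ∑-mono V (λ x → split (E? x) (x ≟ᵛ 𝟎)) ⟩
      ∑[ x ∈ V ] ([ x ≟ᵛ 𝟎 ] + [ E*? x ])           ≡⟨ ∑-+ V (λ x → [ x ≟ᵛ 𝟎 ]) (λ x → [ E*? x ]) ⟩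
      # 𝕍 (_≟ᵛ 𝟎) + # 𝕍 E*?
        ≤⟨ +-monoˡ-≤ _ (#-subsingleton 𝕍 (_≟ᵛ 𝟎) λ x≡𝟎 y≡𝟎 → trans x≡𝟎 (sym y≡𝟎)) ⟩
      suc (# 𝕍 E*?)                                 ∎
      where
      open ≤-Reasoning
      split : ∀ {P Q : Set} (d : Dec P) (e : Dec Q) → [ d ] ≤ [ e ] + [ d ×-dec ¬? e ]
      split (no _)  e       = z≤n
      split (yes _) (yes _) = ≤-refl
      split (yes _) (no _)  = ≤-refl

  -- Moving a vector to the first axis by shears

  record DetPreserving (n : ℕ) : Set where
    field
      apply     : (Fin n → A) → Fin n → A
      injective : ∀ {u v} → apply u ≗ apply v → u ≗ v
      det-apply : ∀ M → det 𝔽 (λ i → apply (M i)) ≡ det 𝔽 M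
  open DetPreserving

  identity : DetPreserving n
  identity = record { apply = id ; injective = id ; det-apply = λ _ → refl }

  shear-after : {p r : Fin n} → Adjacent p r → A → DetPreserving n → DetPreserving n
  shear-after {p = p} {r} p~r a T = record
    { apply     = shear p r a ∘ apply T
    ; injective = λ eq → injective T (shear-injective eq)
    ; det-apply = λ M → trans (det-shear p~r a (λ i → apply T (M i))) (det-apply T M)
    }
    where
    shear-injective : ∀ {u v} → shear p r a u ≗ shear p r a v → u ≗ v
    shear-injective {u} {v} eq k with k ≟ r
    ... | no k≢r   = trans (sym (updateAt-minimal k r u k≢r)) (trans (eq k) (updateAt-minimal k r v k≢r))
    ... | yes refl = +-cancelʳ (a ⊗ u p) _ _ (trans (sym (updateAt-updates r u)) (trans (eq r)
      (trans (updateAt-updates r v) (cong (λ t → v r ⊕ a ⊗ t) (sym (shear-injective-at-p))))))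
      where
      shear-injective-at-p : u p ≡ v p
      shear-injective-at-p = trans (sym (updateAt-minimal p r u (Adjacent-≢ p~r)))
        (trans (eq p) (updateAt-minimal p r v (Adjacent-≢ p~r)))

  module _ {m} (x : Fin (suc m) → A) where

    -- Invariant of a downward sweep over j: the image of x stays nonzero while its support is
    -- pushed into the coordinates up to j. At j = 0 only the first coordinate is left to be
    -- nonzero.
    ClearedAfter : Fin (suc m) → Set
    ClearedAfter j = ∃ λ T → (∃ λ i → apply T x i ≢ 𝟘) × (∀ {k} → j Fin.< k → apply T x k ≡ 𝟘)

    clear : ∀ i T → apply T x (inject₁ i) ≢ 𝟘 → (∀ {k} → suc i Fin.< k → apply T x k ≡ 𝟘) → ClearedAfter (inject₁ i)
    clear i T y≢0 cleared with t , yt≡1 ← inverse _ y≢0 = shear-after (right i) c T ,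
      (inject₁ i , λ eq → y≢0 (trans (sym (updateAt-minimal (inject₁ i) (suc i) y (inject₁≢suc i))) eq)) ,
      after
      where
      y = apply T x
      c = ⊖ y (suc i) ⊗ t
      after : ∀ {k} → inject₁ i Fin.< k → shear (inject₁ i) (suc i) c y k ≡ 𝟘
      after {k} i<k with k ≟ suc i
      ... | yes refl = trans (updateAt-updates (suc i) y) (begin
        y (suc i) ⊕ ⊖ y (suc i) ⊗ t ⊗ y (inject₁ i)
          ≡⟨ cong (y (suc i) ⊕_) (trans (𝔽.*-assoc _ t _) (cong (⊖ y (suc i) ⊗_) (trans (𝔽.*-comm t _) yt≡1))) ⟩
        y (suc i) ⊕ ⊖ y (suc i) ⊗ 𝟙
          ≡⟨ cong (y (suc i) ⊕_) (𝔽.*-identityʳ _) ⟩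
        y (suc i) ⊝ y (suc i)
          ≡⟨ 𝔽.-‿inverseʳ _ ⟩
        𝟘 ∎)
        where open ≡-Reasoning
      ... | no k≢i = trans (updateAt-minimal k (suc i) y k≢i)
        (cleared (Fin.≤∧≢⇒< (subst (_< Fin.toℕ k) (Fin.toℕ-inject₁ i) i<k) (k≢i ∘ sym)))

    clear-step : ∀ i → ClearedAfter (suc i) → ClearedAfter (inject₁ i)
    clear-step i (T , (j , y≢0) , cleared) with apply T x (suc i) ≟ 𝟘 | apply T x (inject₁ i) ≟ 𝟘
    ... | yes y≡0 | _      = T , (j , y≢0) , λ {k} i<k → after k i<k
      where
      after : ∀ k → inject₁ i Fin.< k → apply T x k ≡ 𝟘
      after k i<k with k ≟ suc i
      ... | yes refl = y≡0
      ... | no k≢i   = cleared (Fin.≤∧≢⇒< (subst (_< Fin.toℕ k) (Fin.toℕ-inject₁ i) i<k) (k≢i ∘ sym))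
    ... | no _    | no y≢0′ = clear i T y≢0′ cleared
    -- Coordinate i is zero and cannot serve as pivot, so coordinate i + 1 is first added to it.
    ... | no y≢0′ | yes y≡0 = clear i (shear-after (left i) 𝟙 T)
      (λ eq → y≢0′ (trans (sym (begin
        shear (suc i) (inject₁ i) 𝟙 y (inject₁ i)  ≡⟨ updateAt-updates (inject₁ i) y ⟩
        y (inject₁ i) ⊕ 𝟙 ⊗ y (suc i)              ≡⟨ cong₂ _⊕_ y≡0 (𝔽.*-identityˡ _) ⟩
        𝟘 ⊕ y (suc i)                              ≡⟨ 𝔽.+-identityˡ _ ⟩
        y (suc i)                                  ∎)) eq))
      (λ {k} i<k → trans (updateAt-minimal k (inject₁ i) y λ { refl →
                           <⇒≱ i<k (≤-trans (≤-reflexive (Fin.toℕ-inject₁ i)) (n≤1+n _)) })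
                         (cleared i<k))
      where
      open ≡-Reasoning
      y = apply T x

    to-first-axis : ∀ {i} → x i ≢ 𝟘 →
      ∃ λ T → apply T x zero ≢ 𝟘 × (∀ k → apply T x (suc k) ≡ 𝟘)
    to-first-axis {i} x≢0 with >-weakInduction ClearedAfter
        (identity , (i , x≢0) , λ {k} m<k → contradiction (Fin.≤fromℕ k) (<⇒≱ m<k)) clear-step zero
    ... | T , (zero  , y≢0) , cleared = T , y≢0 , λ k → cleared (s≤s z≤n)
    ... | T , (suc j , y≢0) , cleared = contradiction (cleared (s≤s z≤n)) y≢0

  -- Induction on the dimension

  nonzero-entry : {x : Vec A n} → x ≢ 𝟎 → ∃ λ i → lookup x i ≢ 𝟘
  nonzero-entry {x = []} x≢𝟎 = contradiction refl x≢𝟎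
  nonzero-entry {x = t ∷ x} x≢𝟎 with t ≟ 𝟘
  ... | no t≢0 = zero , t≢0
  ... | yes refl with i , xᵢ≢0 ← nonzero-entry {x = x} (λ { refl → x≢𝟎 refl }) = suc i , xᵢ≢0

  -- Expanding along a row of E sheared onto the first axis leaves a smaller determinant of projections of E.
  allVolumes-suc : ∀ m → AllVolumes m → AllVolumes (suc m)
  allVolumes-suc m IH {E} E? E-large a
    with x , Ex , x≢𝟎 ← nonzero-element E? (≤-trans (2≤2q^n (suc m)) E-large)
    with i , xᵢ≢0 ← nonzero-entry {x = x} x≢𝟎
    with T , α≢0 , axis ← to-first-axis (lookup x) xᵢ≢0
    -- Expansion along the first row multiplies by α, so the smaller determinant has to be α⁻¹ a.
    with α⁻¹ , αα⁻¹≡1 ← inverse _ α≢0 = conclude (IH E′? E′-large (α⁻¹ ⊗ a))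
    where
    α = apply T (lookup x) zero
    π : Vec A (suc (suc m)) → Vec A (suc m)
    π v = tabulate (λ k → apply T (lookup v) (suc k))
    lookup-π : ∀ v k → lookup (π v) k ≡ apply T (lookup v) (suc k)
    lookup-π v k = lookup∘tabulate (λ k → apply T (lookup v) (suc k)) k
    E′ : Vec A (suc m) → Set
    E′ u = ∃ λ v → E v × π v ≡ u
    E′? : Decidable E′
    E′? u = ∃? (vectors _) λ v → E? v ×-dec (π v ≟ᵛ u)
    -- The first coordinate of the sheared v together with `π v` is the whole sheared vector, and
    -- `T` is injective.
    fibre : ∀ u → # (vectors _) (λ v → E? v ×-dec (π v ≟ᵛ u)) ≤ q
    fibre u = ≤-trans
      (#-injective (vectors _) (vectors 1) _≟ᵛ_ (λ v → E? v ×-dec (π v ≟ᵛ u)) (λ _ → yes tt)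
        (λ v → apply T (lookup v) zero ∷ []) _
        λ {v} {v′} (_ , πv≡u) (_ , πv′≡u) eq → lookup-extensional (injective T (λ
          { zero    → proj₁ (∷-injective eq)
          ; (suc k) → trans (sym (lookup-π v k))
              (trans (cong (λ w → lookup w k) (trans πv≡u (sym πv′≡u))) (lookup-π v′ k)) })))
      (≤-reflexive (trans #-all-vectors (*-identityʳ q)))
      where
      lookup-extensional : {v v′ : Vec A n} → lookup v ≗ lookup v′ → v ≡ v′
      lookup-extensional {v = v} {v′} eq = trans (sym (tabulate∘lookup v)) (trans (tabulate-cong eq) (tabulate∘lookup v′))
    E′-large : 2 * q ^ m ≤ # (vectors (suc m)) E′?
    E′-large = *-cancelˡ-≤ q {{>-nonZero (≤-trans (s≤s z≤n) 2≤q)}} (begin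
      q * (2 * q ^ m)               ≡⟨ x∙yz≈y∙xz-ℕ q 2 (q ^ m) ⟩
      2 * q ^ suc m                 ≤⟨ E-large ⟩
      # (vectors (suc (suc m))) E?
        ≤⟨ #≤fibre*# (vectors _) (vectors _) _≟ᵛ_ E? E′? π q (λ {v} Ev → v , Ev , refl) fibre ⟩
      q * # (vectors (suc m)) E′?   ∎)
      where
      open ≤-Reasoning
      open import Algebra.Properties.CommutativeSemigroup *-commutativeSemigroup using () renaming (x∙yz≈y∙xz to x∙yz≈y∙xz-ℕ)
    conclude : (∃ λ (u : Fin (suc m) → Vec A (suc m)) → (∀ i → E′ (u i)) × det 𝔽 (λ i → lookup (u i)) ≡ α⁻¹ ⊗ a) →
               ∃ λ (v : Fin (suc (suc m)) → Vec A (suc (suc m))) → (∀ i → E (v i)) × det 𝔽 (λ i → lookup (v i)) ≡ a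
    conclude (u , E′u , det≡) = v , (λ { zero → Ex ; (suc i) → proj₁ (proj₂ (E′u i)) }) , (begin
      det 𝔽 (λ i → lookup (v i))                      ≡⟨ det-apply T (λ i → lookup (v i)) ⟨
      det 𝔽 TM                                        ≡⟨ cong₂ _⊕_ refl (sumFin-zero λ k →
                                                           trans (cong (_⊗ det 𝔽 (minor TM (suc k)))
                                                             (trans (cong (sign 𝔽 (Fin.toℕ (suc k)) ⊗_) (axis k)) (𝔽.zeroʳ _))) (𝔽.zeroˡ _)) ⟩
      𝟙 ⊗ α ⊗ det 𝔽 (minor TM zero) ⊕ 𝟘
        ≡⟨ trans (𝔽.+-identityʳ _) (cong₂ _⊗_ (𝔽.*-identityˡ α) (det-cong (λ i k →
                                                           trans (sym (lookup-π (v (suc i)) k)) (cong (λ w → lookup w k) (proj₂ (proj₂ (E′u i))))))) ⟩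
      α ⊗ det 𝔽 (λ i → lookup (u i))                  ≡⟨ cong (α ⊗_) det≡ ⟩
      α ⊗ (α⁻¹ ⊗ a)                                   ≡⟨ 𝔽.*-assoc α α⁻¹ a ⟨
      α ⊗ α⁻¹ ⊗ a                                     ≡⟨ cong (_⊗ a) αα⁻¹≡1 ⟩
      𝟙 ⊗ a                                           ≡⟨ 𝔽.*-identityˡ a ⟩
      a                                               ∎)
      where
      open ≡-Reasoning
      v : Fin (suc (suc m)) → Vec A (suc (suc m))
      v zero    = x
      v (suc i) = proj₁ (E′u i)
      TM : Matrix (suc (suc m))
      TM i = apply T (lookup (v i))

  allVolumes : ∀ m → AllVolumes (suc (suc m))
  allVolumes zero    = allVolumes₃
  allVolumes (suc m) = allVolumes-suc (suc (suc m)) (allVolumes m)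

-- Transfer to an arbitrary finite field

open import Data.List using (lookup)
open import Data.Nat.Divisibility using (_∣_)
open import Data.Nat.Primality using (Prime)
open import Function.Bundles using (Inverse)
open import Relation.Binary.PropositionalEquality.Properties using (setoid)

fins : ∀ n → Finite (Fin n)
fins n = record { elements = allFin n ; unique = Unique.allFin⁺ n ; complete = ∈-allFin }

-- Here R stands for being distinct. `AllPairs` covers only pairs in list order, so symmetry covers
-- the rest, and the premise `¬ R` lets equality of codes enter without deciding equality in the
-- field.
lookup-injective : ∀ {a r} {X : Set a} {R : X → X → Set r} {xs : List X} → AllPairs R xs →
  (∀ {x y} → R x y → R y x) → ∀ i j → ¬ R (lookup xs i) (lookup xs j) → i ≡ j
lookup-injective (rs ∷ pairs) R-sym zero    zero    _  = refl
lookup-injective (rs ∷ pairs) R-sym zero    (suc j) ¬r = contradiction (All.lookup rs (∈-lookup j)) ¬r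
lookup-injective (rs ∷ pairs) R-sym (suc i) zero    ¬r = contradiction (R-sym (All.lookup rs (∈-lookup i))) ¬r
lookup-injective (rs ∷ pairs) R-sym (suc i) (suc j) ¬r = cong suc (lookup-injective pairs R-sym i j ¬r)

module Transfer {c ℓ q} (F : Field c ℓ) (code : Inverse (Field.setoid F) (setoid (Fin q))) where

  private
    module F = Field F
  open Inverse code

  -- The operations are carried over along the bijection, so that `from` is a ring monomorphism by
  -- construction and the ring laws can be pulled back through it. Equality thereby becomes
  -- propositional and decidable.
  finRawRing : RawRing 0ℓ 0ℓ
  finRawRing = record
    { Carrier = Fin q
    ; _≈_     = _≡_
    ; _+_     = λ x y → to (from x F.+ from y)
    ; _*_     = λ x y → to (from x F.* from y)
    ; -_      = λ x → to (F.- from x)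
    ; 0#      = to F.0#
    ; 1#      = to F.1#
    }

  from-isRingMonomorphism : IsRingMonomorphism finRawRing (CommutativeRing.rawRing F.commutativeRing) from
  from-isRingMonomorphism = record
    { isRingHomomorphism = record
      { isSemiringHomomorphism = record
        { isNearSemiringHomomorphism = record
          { +-isMonoidHomomorphism = record
            { isMagmaHomomorphism = record
              { isRelHomomorphism = record { cong = from-cong }
              ; homo = λ _ _ → strictlyInverseʳ _
              }
            ; ε-homo = strictlyInverseʳ _
            }
          ; *-homo = λ _ _ → strictlyInverseʳ _
          }
        ; 1#-homo = strictlyInverseʳ _
        }
      ; -‿homo = λ _ → strictlyInverseʳ _
      }
    ; injective = λ {x} {y} eq → trans (sym (strictlyInverseˡ x)) (trans (to-cong eq) (strictlyInverseˡ y))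
    }

  open import Algebra.Morphism.RingMonomorphism from-isRingMonomorphism using (isCommutativeRing)

  finCommutativeRing : CommutativeRing 0ℓ 0ℓ
  finCommutativeRing = record { isCommutativeRing = isCommutativeRing F.isCommutativeRing }

  to-1≢to-0 : to F.1# ≢ to F.0#
  to-1≢to-0 eq = F.1≉0 (F.trans (F.sym (strictlyInverseʳ F.1#)) (F.trans (from-cong eq) (strictlyInverseʳ F.0#)))

  fin-inverse : ∀ x → x ≢ to F.0# → ∃ λ y → to (from x F.* from y) ≡ to F.1#
  fin-inverse x x≢0 with y , xy≈1 ← F.inverse (from x) (λ x≈0 → x≢0 (trans (sym (strictlyInverseˡ x)) (to-cong x≈0))) =
    to y , to-cong (F.trans (F.*-congˡ (strictlyInverseʳ y)) xy≈1)

  private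
    R = finCommutativeRing

  from-sumFin : ∀ {n} (f : Fin n → Fin q) → from (sumFin R f) F.≈ sumFin F.commutativeRing (from ∘ f)
  from-sumFin {zero}  f = strictlyInverseʳ _
  from-sumFin {suc n} f = F.trans (strictlyInverseʳ _) (F.+-congˡ (from-sumFin (f ∘ suc)))

  from-sign : ∀ n → from (sign R n) F.≈ sign F.commutativeRing n
  from-sign zero    = strictlyInverseʳ _
  from-sign (suc n) = F.trans (strictlyInverseʳ _) (F.-‿cong (from-sign n))

  from-det : ∀ {n} (M : Fin n → Fin n → Fin q) → from (det R M) F.≈ det F.commutativeRing (λ i j → from (M i j))
  from-det {zero}  M = strictlyInverseʳ _
  from-det {suc n} M = F.trans (from-sumFin (Determinant.cofactorTerm R M))
    (Determinant.sumFin-cong F.commutativeRing λ j →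
    F.trans (strictlyInverseʳ _) (F.*-cong
      (F.trans (strictlyInverseʳ _) (F.*-congʳ {x = from (M zero j)} (from-sign (toℕ j))))
      (from-det (λ i k → M (suc i) (punchIn j k)))))

  open FiniteField (isCommutativeRing F.isCommutativeRing) to-1≢to-0 fin-inverse using (vectors; _≟ᵛ_; allVolumes)

  encode : ∀ {n} → (Fin n → F.Carrier) → Vec (Fin q) n
  encode u = Vec.tabulate (to ∘ u)

  from-encode : ∀ {n} (u : Fin n → F.Carrier) i → from (Vec.lookup (encode u) i) F.≈ u i
  from-encode u i = F.trans (from-cong (lookup∘tabulate (to ∘ u) i)) (strictlyInverseʳ (u i))

  encode-injective : ∀ {n} {u v : Fin n → F.Carrier} → encode u ≡ encode v → ∀ i → u i F.≈ v i
  encode-injective {u = u} {v} eq i = F.trans (F.sym (from-encode u i))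
    (F.trans (from-cong (cong (λ w → Vec.lookup w i) eq)) (from-encode v i))

  volumes : ∀ m (E : List (Fin (3 + m) → F.Carrier)) → AllPairs (λ u v → ¬ (∀ i → u i F.≈ v i)) E →
    2 * q ^ (2 + m) ≤ length E →
    ∀ a → ∃ λ (x : Fin (3 + m) → Fin (length E)) → det F.commutativeRing (λ j → lookup E (x j)) F.≈ a
  volumes m E distinct E-large a = let v , Ev , det≡ = allVolumes m Code? Code-large (to a) in
    (λ j → proj₁ (Ev j)) ,
    F.trans (Determinant.det-cong F.commutativeRing λ i k → F.trans (F.sym (from-encode (lookup E (proj₁ (Ev i))) k))
                                       (from-cong (cong (λ w → Vec.lookup w k) (proj₂ (Ev i)))))
      (F.trans (F.sym (from-det (λ i → Vec.lookup (v i)))) (F.trans (from-cong det≡) (strictlyInverseʳ a)))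
    where
    -- Membership carries a list index, from which the rows sought are read off. Distinctness of the
    -- entries makes the codes at least as many as the indices.
    Code : Vec (Fin q) (3 + m) → Set
    Code v = ∃ λ i → encode (lookup E i) ≡ v
    Code? : Decidable Code
    Code? v = ∃? (fins (length E)) (λ i → encode (lookup E i) ≟ᵛ v)
    Code-large : 2 * q ^ (2 + m) ≤ # (vectors (3 + m)) Code?
    Code-large = begin
      2 * q ^ (2 + m)              ≤⟨ E-large ⟩
      length E
        ≡⟨ trans (∑-const (allFin (length E)) 1) (trans (*-identityʳ _) (length-tabulate {n = length E} id)) ⟨
      # (fins (length E)) (λ _ → yes tt)
        ≤⟨ #-injective (fins (length E)) (vectors _) _≟ᵛ_ (λ _ → yes tt) Code?
                                                 (λ i → encode (lookup E i)) (λ {i} _ → i , refl)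
                                                 (λ {i} {j} _ _ eq → lookup-injective distinct (λ u≉v v≈u → u≉v (λ k → F.sym (v≈u k)))
                                                   i j λ u≉v → u≉v (encode-injective eq)) ⟩
      # (vectors (3 + m)) Code?    ∎
      where
      open ≤-Reasoning

theorem1p2 : ∀ {c ℓ} (F : Field c ℓ) (q p k : ℕ)
    → Prime p → ¬ (2 ∣ p) → 1 ≤ k → q ≡ p ^ k
    → Inverse (Field.setoid F) (setoid (Fin q))
    → (d : ℕ) → 3 ≤ d
    → (E : List (Fin d → Field.Carrier F))
    → AllPairs (λ u v → ¬ (∀ i → Field._≈_ F (u i) (v i))) E
    → (d ∸ 1) * q ^ (d ∸ 1) ≤ length E
    → ∀ (a : Field.Carrier F)
    → ∃ λ (x : Fin d → Fin (length E))
    → Field._≈_ F (det (Field.commutativeRing F) (λ j → lookup E (x j))) a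
theorem1p2 F q _ _ _ _ _ _ code (suc (suc (suc m))) (s≤s (s≤s (s≤s z≤n))) E distinct E-large =
  -- The factor d - 1 is at least 2, the constant that passes unchanged from one dimension to the
  -- next.
  Transfer.volumes F code m E distinct (≤-trans (*-monoˡ-≤ (q ^ suc (suc m)) (s≤s (s≤s (z≤n {m})))) E-large)
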